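{- $n(2,4)=9$, $n(2,5)\le 14$, $n(2,6)\le 21$, $n(2,7)\le 29$, $n(2,8)\le 45$, $n(2,9)\le 70$, and $n(2,10)\le 95$.
   Context: A standard box in $\mathbb{R}^d$ is a set $K=K_1\times\cdots\times K_d$ where each $K_i\subseteq\mathbb{R}$ is a closed interval. A finite family of $d$-dimensional standard boxes in $\mathbb{R}^d$ is called $k$-neighborly if the dimension of the intersection of any two distinct members is in $\{d-k,d-k+1,\ldots,d-1\}$ (in particular the intersection is nonempty). For positive integers $1\le k\le d$, $n(k,d)$ is the maximum number of members of a $k$-neighborly family of $d$-dimensional standard boxes in $\mathbb{R}^d$. -}

module Defs where

open import Data.Fin using (Fin)
open import Data.Nat as ℕ using (ℕ; suc; _∸_; _⊔_)
open import Data.Nat.Properties using (m≤m⊔n; m≤n⊔m)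
  renaming (≤-refl to ℕ-≤-refl; ≤-trans to ℕ-≤-trans)
open import Data.Product using (∃; _×_; _,_)
open import Data.Rational as ℚ using (ℚ; 0ℚ; 1ℚ; ½; ∣_∣; 1/_; Positive; positive; nonNegative)
open import Data.Rational.Properties
open import Data.Rational.Solver using (module +-*-Solver)
open import Data.Vec.Functional using (Vector; foldr)
open import Level using (0ℓ)
open import Relation.Binary.PropositionalEquality
  using (_≡_; _≢_; refl; sym; trans; cong; subst)
open import Relation.Unary using (Pred; _∈_; _∩_)

------------------------------------------------------------------------
-- Real numbers: Cauchy sequences of rationals, with the equality _≃_

IsCauchy : (ℕ → ℚ) → Set
IsCauchy s = ∀ ε → 0ℚ ℚ.< ε →
  ∃ λ N → ∀ m n → N ℕ.≤ m → N ℕ.≤ n → ∣ s m ℚ.- s n ∣ ℚ.< ε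

record ℝ : Set where
  constructor mkℝ
  field
    seq    : ℕ → ℚ
    cauchy : IsCauchy seq

open ℝ public

infix 4 _≃_ _≤ᴿ_

_≃_ : ℝ → ℝ → Set
x ≃ y = ∀ ε → 0ℚ ℚ.< ε →
  ∃ λ N → ∀ n → N ℕ.≤ n → ∣ seq x n ℚ.- seq y n ∣ ℚ.< ε

_≤ᴿ_ : ℝ → ℝ → Set
x ≤ᴿ y = ∀ ε → 0ℚ ℚ.< ε →
  ∃ λ N → ∀ n → N ℕ.≤ n → seq x n ℚ.< seq y n ℚ.+ ε

fromℚ : ℚ → ℝ
fromℚ q = mkℝ (λ _ → q) λ ε 0<ε →
  0 , λ _ _ _ _ → subst (λ t → ∣ t ∣ ℚ.< ε) (sym (+-inverseʳ q)) 0<ε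

0ᴿ : ℝ
0ᴿ = fromℚ 0ℚ

private
  open +-*-Solver

  abstract
    halve : ∀ ε → 0ℚ ℚ.< ε → ∃ λ δ → 0ℚ ℚ.< δ × δ ℚ.+ δ ≡ ε
    halve ε 0<ε = ½ ℚ.* ε
      , subst (ℚ._< ½ ℚ.* ε) (*-zeroʳ ½) (*-monoʳ-<-pos ½ 0<ε)
      , trans (sym (*-distribʳ-+ ε ½ ½)) (*-identityˡ ε)

    +-cauchy : ∀ {s t} → IsCauchy s → IsCauchy t → IsCauchy (λ n → s n ℚ.+ t n)
    +-cauchy {s} {t} cs ct ε 0<ε with halve ε 0<ε
    ... | δ , 0<δ , δ+δ≡ε with cs δ 0<δ | ct δ 0<δ
    ... | N₁ , sδ | N₂ , tδ = N₁ ⊔ N₂ , bound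
      where
      split : ∀ a b c d → (a ℚ.+ b) ℚ.- (c ℚ.+ d) ≡ (a ℚ.- c) ℚ.+ (b ℚ.- d)
      split = solve 4 (λ a b c d →
        (a :+ b) :- (c :+ d) := (a :- c) :+ (b :- d)) refl
      open ≤-Reasoning
      bound : ∀ m n → N₁ ⊔ N₂ ℕ.≤ m → N₁ ⊔ N₂ ℕ.≤ n →
              ∣ (s m ℚ.+ t m) ℚ.- (s n ℚ.+ t n) ∣ ℚ.< ε
      bound m n N≤m N≤n = begin-strict
        ∣ (s m ℚ.+ t m) ℚ.- (s n ℚ.+ t n) ∣    ≡⟨ cong ∣_∣ (split (s m) (t m) (s n) (t n)) ⟩
        ∣ (s m ℚ.- s n) ℚ.+ (t m ℚ.- t n) ∣    ≤⟨ ∣p+q∣≤∣p∣+∣q∣ (s m ℚ.- s n) (t m ℚ.- t n) ⟩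
        ∣ s m ℚ.- s n ∣ ℚ.+ ∣ t m ℚ.- t n ∣    <⟨ +-mono-< (sδ m n (l N≤m) (l N≤n))
                                                          (tδ m n (r N≤m) (r N≤n)) ⟩
        δ ℚ.+ δ                                ≡⟨ δ+δ≡ε ⟩
        ε                                      ∎
        where
        l : ∀ {k} → N₁ ⊔ N₂ ℕ.≤ k → N₁ ℕ.≤ k
        l = ℕ-≤-trans (m≤m⊔n N₁ N₂)
        r : ∀ {k} → N₁ ⊔ N₂ ℕ.≤ k → N₂ ℕ.≤ k
        r = ℕ-≤-trans (m≤n⊔m N₁ N₂)

    cauchy⇒bounded : ∀ {s} → IsCauchy s →
      ∃ λ B → 0ℚ ℚ.< B × ∃ λ N → ∀ n → N ℕ.≤ n → ∣ s n ∣ ℚ.≤ B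
    cauchy⇒bounded {s} cs with cs 1ℚ (positive⁻¹ 1ℚ)
    ... | N , close =
      1ℚ ℚ.+ ∣ s N ∣ , +-mono-<-≤ (positive⁻¹ 1ℚ) (0≤∣p∣ (s N)) , N , bound
      where
      split : ∀ a b → a ≡ (a ℚ.- b) ℚ.+ b
      split = solve 2 (λ a b → a := (a :- b) :+ b) refl
      open ≤-Reasoning
      bound : ∀ n → N ℕ.≤ n → ∣ s n ∣ ℚ.≤ 1ℚ ℚ.+ ∣ s N ∣
      bound n N≤n = begin
        ∣ s n ∣                     ≡⟨ cong ∣_∣ (split (s n) (s N)) ⟩
        ∣ (s n ℚ.- s N) ℚ.+ s N ∣   ≤⟨ ∣p+q∣≤∣p∣+∣q∣ (s n ℚ.- s N) (s N) ⟩
        ∣ s n ℚ.- s N ∣ ℚ.+ ∣ s N ∣ ≤⟨ +-monoˡ-≤ ∣ s N ∣ (<⇒≤ (close n N N≤n ℕ-≤-refl)) ⟩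
        1ℚ ℚ.+ ∣ s N ∣              ∎

    divide : ∀ C ε → Positive C → 0ℚ ℚ.< ε → ∃ λ δ → 0ℚ ℚ.< δ × C ℚ.* δ ℚ.< ε
    divide C ε C>0 0<ε with halve ε 0<ε
    ... | η , 0<η , η+η≡ε = i ℚ.* η , 0<iη , (begin-strict
      C ℚ.* (i ℚ.* η) ≡⟨ *-assoc C i η ⟨
      C ℚ.* i ℚ.* η   ≡⟨ cong (ℚ._* η) (*-inverseʳ C) ⟩
      1ℚ ℚ.* η        ≡⟨ *-identityˡ η ⟩
      η               ≡⟨ +-identityˡ η ⟨
      0ℚ ℚ.+ η        <⟨ +-monoˡ-< η 0<η ⟩
      η ℚ.+ η         ≡⟨ η+η≡ε ⟩
      ε               ∎)
      where
      instance
        posC : Positive C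
        posC = C>0
        nonZeroC : ℚ.NonZero C
        nonZeroC = pos⇒nonZero C
      i : ℚ
      i = 1/ C
      0<iη : 0ℚ ℚ.< i ℚ.* η
      0<iη = subst (ℚ._< i ℚ.* η) (*-zeroʳ i) (*-monoʳ-<-pos i {{1/pos⇒pos C}} 0<η)
      open ≤-Reasoning

    ∣*∣-mono : ∀ p q {P Q} → ∣ p ∣ ℚ.≤ P → ∣ q ∣ ℚ.≤ Q → ∣ p ℚ.* q ∣ ℚ.≤ P ℚ.* Q
    ∣*∣-mono p q {P} {Q} p≤P q≤Q = begin
      ∣ p ℚ.* q ∣     ≡⟨ ∣p*q∣≡∣p∣*∣q∣ p q ⟩
      ∣ p ∣ ℚ.* ∣ q ∣ ≤⟨ *-monoʳ-≤-nonNeg ∣ q ∣ {{∣-∣-nonNeg q}} p≤P ⟩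
      P ℚ.* ∣ q ∣     ≤⟨ *-monoˡ-≤-nonNeg P {{nonNegative (≤-trans (0≤∣p∣ p) p≤P)}} q≤Q ⟩
      P ℚ.* Q         ∎
      where open ≤-Reasoning

    *-difference : ∀ {A B δ ε} a b c d → (A ℚ.+ B) ℚ.* δ ℚ.< ε →
      ∣ a ∣ ℚ.≤ A → ∣ d ∣ ℚ.≤ B → ∣ a ℚ.- c ∣ ℚ.≤ δ → ∣ b ℚ.- d ∣ ℚ.≤ δ →
      ∣ a ℚ.* b ℚ.- c ℚ.* d ∣ ℚ.< ε
    *-difference {A} {B} {δ} {ε} a b c d [A+B]δ<ε a≤A d≤B ac≤δ bd≤δ = begin-strict
      ∣ a ℚ.* b ℚ.- c ℚ.* d ∣                       ≡⟨ cong ∣_∣ (split a b c d) ⟩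
      ∣ a ℚ.* (b ℚ.- d) ℚ.+ d ℚ.* (a ℚ.- c) ∣       ≤⟨ ∣p+q∣≤∣p∣+∣q∣ (a ℚ.* (b ℚ.- d)) (d ℚ.* (a ℚ.- c)) ⟩
      ∣ a ℚ.* (b ℚ.- d) ∣ ℚ.+ ∣ d ℚ.* (a ℚ.- c) ∣   ≤⟨ +-mono-≤ (∣*∣-mono a (b ℚ.- d) a≤A bd≤δ)
                                                                (∣*∣-mono d (a ℚ.- c) d≤B ac≤δ) ⟩
      A ℚ.* δ ℚ.+ B ℚ.* δ                           ≡⟨ *-distribʳ-+ δ A B ⟨
      (A ℚ.+ B) ℚ.* δ                               <⟨ [A+B]δ<ε ⟩
      ε                                             ∎
      where
      split : ∀ a b c d →
        a ℚ.* b ℚ.- c ℚ.* d ≡ a ℚ.* (b ℚ.- d) ℚ.+ d ℚ.* (a ℚ.- c)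
      split = solve 4 (λ a b c d →
        a :* b :- c :* d := a :* (b :- d) :+ d :* (a :- c)) refl
      open ≤-Reasoning

    *-cauchy : ∀ {s t} → IsCauchy s → IsCauchy t → IsCauchy (λ n → s n ℚ.* t n)
    *-cauchy {s} {t} cs ct ε 0<ε =
      let A , A>0 , N₁ , s≤A = cauchy⇒bounded cs
          B , B>0 , N₂ , t≤B = cauchy⇒bounded ct
          δ , 0<δ , [A+B]δ<ε = divide (A ℚ.+ B) ε (positive (+-mono-< A>0 B>0)) 0<ε
      in combine N₁ N₂ s≤A t≤B [A+B]δ<ε (cs δ 0<δ) (ct δ 0<δ)
      where
      combine : ∀ {A B δ} N₁ N₂ →
        (∀ n → N₁ ℕ.≤ n → ∣ s n ∣ ℚ.≤ A) →
        (∀ n → N₂ ℕ.≤ n → ∣ t n ∣ ℚ.≤ B) →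
        (A ℚ.+ B) ℚ.* δ ℚ.< ε →
        (∃ λ N → ∀ m n → N ℕ.≤ m → N ℕ.≤ n → ∣ s m ℚ.- s n ∣ ℚ.< δ) →
        (∃ λ N → ∀ m n → N ℕ.≤ m → N ℕ.≤ n → ∣ t m ℚ.- t n ∣ ℚ.< δ) →
        ∃ λ N → ∀ m n → N ℕ.≤ m → N ℕ.≤ n → ∣ s m ℚ.* t m ℚ.- s n ℚ.* t n ∣ ℚ.< ε
      combine N₁ N₂ s≤A t≤B [A+B]δ<ε (N₃ , sδ) (N₄ , tδ) =
        (N₁ ⊔ N₂) ⊔ (N₃ ⊔ N₄) , λ m n N≤m N≤n →
        *-difference (s m) (t m) (s n) (t n) [A+B]δ<ε
          (s≤A m (ℕ-≤-trans (m≤m⊔n N₁ N₂) (l N≤m)))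
          (t≤B n (ℕ-≤-trans (m≤n⊔m N₁ N₂) (l N≤n)))
          (<⇒≤ (sδ m n (ℕ-≤-trans (m≤m⊔n N₃ N₄) (r N≤m)) (ℕ-≤-trans (m≤m⊔n N₃ N₄) (r N≤n))))
          (<⇒≤ (tδ m n (ℕ-≤-trans (m≤n⊔m N₃ N₄) (r N≤m)) (ℕ-≤-trans (m≤n⊔m N₃ N₄) (r N≤n))))
        where
        l : ∀ {k} → (N₁ ⊔ N₂) ⊔ (N₃ ⊔ N₄) ℕ.≤ k → N₁ ⊔ N₂ ℕ.≤ k
        l = ℕ-≤-trans (m≤m⊔n (N₁ ⊔ N₂) (N₃ ⊔ N₄))
        r : ∀ {k} → (N₁ ⊔ N₂) ⊔ (N₃ ⊔ N₄) ℕ.≤ k → N₃ ⊔ N₄ ℕ.≤ k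
        r = ℕ-≤-trans (m≤n⊔m (N₁ ⊔ N₂) (N₃ ⊔ N₄))

infixl 6 _+ᴿ_
infixl 7 _*ᴿ_

_+ᴿ_ : ℝ → ℝ → ℝ
x +ᴿ y = mkℝ (λ n → seq x n ℚ.+ seq y n) (+-cauchy {seq x} {seq y} (cauchy x) (cauchy y))

_*ᴿ_ : ℝ → ℝ → ℝ
x *ᴿ y = mkℝ (λ n → seq x n ℚ.* seq y n) (*-cauchy {seq x} {seq y} (cauchy x) (cauchy y))

∑ : ∀ {n} → Vector ℝ n → ℝ
∑ = foldr _+ᴿ_ 0ᴿ

------------------------------------------------------------------------
-- Affine dimension of subsets of ℝᵈ

record IsMaximum (P : ℕ → Set) (m : ℕ) : Set where
  field
    attained   : P m
    upperBound : ∀ n → P n → n ℕ.≤ m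

Point : ℕ → Set
Point d = Vector ℝ d

AffinelyIndependent : ∀ {d n} → (Fin n → Point d) → Set
AffinelyIndependent {d} {n} p = (c : Vector ℝ n) →
  ∑ c ≃ 0ᴿ →
  (∀ j → ∑ (λ i → c i *ᴿ p i j) ≃ 0ᴿ) →
  ∀ i → c i ≃ 0ᴿ

-- The dimension of the affine hull of S: the largest r for which S contains
-- r + 1 affinely independent points.  The empty set has no dimension.
HasDimension : ∀ {d} → Pred (Point d) 0ℓ → ℕ → Set
HasDimension {d} S = IsMaximum λ r →
  ∃ λ (p : Fin (suc r) → Point d) → (∀ i → p i ∈ S) × AffinelyIndependent p

------------------------------------------------------------------------
-- Neighborly families of boxes

-- Single points count as closed intervals, so a box may have dimension < d.
record StandardBox (d : ℕ) : Set where
  field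
    lower upper : Point d
    lower≤upper : ∀ j → lower j ≤ᴿ upper j

  region : Pred (Point d) 0ℓ
  region x = ∀ j → lower j ≤ᴿ x j × x j ≤ᴿ upper j

open StandardBox public

-- Distinct indices give distinct boxes: a d-dimensional box meets itself in
-- dimension d, which `neighborly` excludes.
record IsNeighborlyFamily (k d : ℕ) {m : ℕ} (K : Fin m → StandardBox d) : Set where
  field
    fullDimensional : ∀ i → HasDimension (region (K i)) d
    neighborly      : ∀ i j → i ≢ j → ∃ λ r →
      HasDimension (region (K i) ∩ region (K j)) r × d ∸ k ℕ.≤ r × r ℕ.< d

NeighborlyFamilyOfSize : ℕ → ℕ → ℕ → Set
NeighborlyFamilyOfSize k d m = ∃ λ (K : Fin m → StandardBox d) → IsNeighborlyFamily k d K

-- n(k,d) is the maximum of NeighborlyFamilyOfSize k d.  It is treated as a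
-- relation, since computing it as a function would amount to a finite search
-- for the exact value; n(k,d) ≤ b says that b bounds every family size.
infix 4 n⟨_,_⟩≡_ n⟨_,_⟩≤_

n⟨_,_⟩≡_ : ℕ → ℕ → ℕ → Set
n⟨ k , d ⟩≡ m = IsMaximum (NeighborlyFamilyOfSize k d) m

n⟨_,_⟩≤_ : ℕ → ℕ → ℕ → Set
n⟨ k , d ⟩≤ b = ∀ m → NeighborlyFamilyOfSize k d m → m ℕ.≤ b

{-# OPTIONS --safe #-}
module Submission where

open import Data.Product using (_×_)
open import Defs

open import Algebra.Bundles using (CommutativeRing)
import Algebra.Properties.Group
import Algebra.Properties.Ring
import Algebra.Properties.Semiring.Sum
open import Data.Bool using (Bool; true; false; not; if_then_else_)
open import Data.Fin as Fin using (Fin; zero; suc; punchIn; inject≤; quotient; remainder)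
open import Data.Fin.Properties using (any?; all?; sequence; inject≤-injective; toℕ-fromℕ<)
  renaming (_≟_ to _≟F_; suc-injective to sucF-injective)
open import Data.Nat as ℕ using (ℕ; zero; suc; z≤n; s≤s)
open import Data.Nat.Induction using (<-wellFounded)
import Data.Nat.Properties as ℕ
open import Data.Nat.Solver using (module +-*-Solver)
open import Data.Product using (∃; _,_; proj₁; proj₂)
open import Data.Rational as ℚ using (ℚ; 0ℚ; 1ℚ; ½; ∣_∣; 1/_; Positive; positive; nonNegative)
import Data.Rational.Properties as ℚ
open import Data.Rational.Solver using () renaming (module +-*-Solver to ℚ-Solver)
open import Data.Sum using (_⊎_; inj₁; inj₂; [_,_]′)
open import Data.Vec.Functional using (Vector; []; _∷_; _++_; tail; insertAt; removeAt; updateAt)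
open import Data.Vec.Functional.Properties
  using (insertAt-lookup; insertAt-punchIn; updateAt-updates; updateAt-minimal)
open import Effect.Monad using (RawMonad)
open import Function using (_∘_; const; case_of_)
open import Induction.WellFounded using (Acc; acc)
open import Level using (0ℓ)
open import Relation.Binary.PropositionalEquality
  using (_≡_; _≢_; refl; sym; trans; cong; cong₂; subst; module ≡-Reasoning)
import Relation.Binary.Reasoning.Setoid
open import Relation.Nullary using (¬_; Dec; yes; no; does; contradiction; ¬?; _×-dec_; _→-dec_)
open import Relation.Nullary.Decidable
  using (True; toWitness; from-yes; decidable-stable; ¬¬-excluded-middle)
open import Relation.Nullary.Negation using (¬¬-Monad)
open import Relation.Unary using (Pred; _∈_; _∩_)

open Algebra.Properties.Semiring.Sum ℕ.+-*-semiring
  using (sum)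

-- In each coordinate the intervals of a neighborly family pairwise meet, so all
-- pairs that meet in a single point meet in the same one.  Writing 𝟎 or 𝟏 for
-- an interval that ends or begins there and ✶ for the others turns boxes into
-- words, and the codimension of an intersection into the number of positions
-- with 𝟎 against 𝟏: any two words must be at distance 1 or 2.  The bounds being
-- decidable, real numbers may be compared under double negation.
--
-- Two inequalities control the total support S (number of letters 𝟎 and 𝟏) of n
-- words of length d.  Words are disjoint subcubes of {0,1}ᵈ, and words containing
-- antipodal points have supports s + s′ ≤ d + 2; averaging over the cube gives
-- 2 ∑ (s + 1) 2^(d − s) ≤ 2^d (d + 4), so S is large.  On the other hand, after
-- replacing letters by ✶ as long as possible, a word of support s is at distance
-- exactly 1 from at least s others, so 2 ∑ⱼ #𝟎(j) #𝟏(j) + S ≤ 2n(n − 1).  The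
-- words without 𝟏 at j form a family in dimension d − 1, hence
-- #𝟎(j), #𝟏(j) ≥ n − n(2,d−1), and S is small.  Starting from n(2,0) = 1, the two
-- estimates collide in each dimension up to 10.

-- Sums of natural numbers

sum-mono : ∀ {n} {f g : Vector ℕ n} → (∀ a → f a ℕ.≤ g a) → sum f ℕ.≤ sum g
sum-mono {zero}  f≤g = z≤n
sum-mono {suc n} f≤g = ℕ.+-mono-≤ (f≤g zero) (sum-mono (f≤g ∘ suc))

sum-mono-< : ∀ {n} {f g : Vector ℕ n} → (∀ a → f a ℕ.≤ g a) → (∃ λ a → f a ℕ.< g a) → sum f ℕ.< sum g
sum-mono-< f≤g (zero  , f<g) = ℕ.+-mono-<-≤ f<g (sum-mono (f≤g ∘ suc))
sum-mono-< f≤g (suc a , f<g) = ℕ.+-mono-≤-< (f≤g zero) (sum-mono-< (f≤g ∘ suc) (a , f<g))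

sum-const : ∀ n c → sum {n} (const c) ≡ n ℕ.* c
sum-const zero    c = refl
sum-const (suc n) c = cong (c ℕ.+_) (sum-const n c)

sum-zero : ∀ {n} {f : Vector ℕ n} → (∀ a → f a ≡ 0) → sum f ≡ 0
sum-zero {zero}  f≡0 = refl
sum-zero {suc n} f≡0 = cong₂ ℕ._+_ (f≡0 zero) (sum-zero (f≡0 ∘ suc))

term≤sum : ∀ {n} (f : Vector ℕ n) a → f a ℕ.≤ sum f
term≤sum f zero    = ℕ.m≤m+n (f zero) _
term≤sum f (suc a) = ℕ.≤-trans (term≤sum (f ∘ suc) a) (ℕ.m≤n+m _ (f zero))

AtMostOneNonzero : ∀ {n} → Vector ℕ n → Set
AtMostOneNonzero f = ∀ {a b} → a ≢ b → f a ≢ 0 → f b ≡ 0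

-- Meant for a vertex of the cube, which at most one of several disjoint subcubes contains.
sum-atMostOneNonzero : ∀ {n} (f : Vector ℕ n) → AtMostOneNonzero f →
  sum f ≡ 0 ⊎ (∃ λ a → f a ≢ 0 × sum f ≡ f a)
sum-atMostOneNonzero {zero} f single = inj₁ refl
sum-atMostOneNonzero {suc n} f single with f zero ℕ.≟ 0
... | no  f₀≢0 = inj₂ (zero , f₀≢0 ,
        trans (cong (f zero ℕ.+_) (sum-zero λ a → single {zero} {suc a} (λ ()) f₀≢0)) (ℕ.+-identityʳ (f zero)))
... | yes f₀≡0 with sum-atMostOneNonzero (f ∘ suc) (λ a≢b → single (a≢b ∘ sucF-injective))
...   | inj₁ ≡0               = inj₁ (cong₂ ℕ._+_ f₀≡0 ≡0)
...   | inj₂ (a , fa≢0 , ≡fa) = inj₂ (suc a , fa≢0 , cong₂ ℕ._+_ f₀≡0 ≡fa)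

indicator : Bool → ℕ
indicator b = if b then 1 else 0

-- Turns a decidable subset of the indices into an index type of its own, so that a bound for
-- families applies to a subfamily.
enumerate : ∀ {n} (q : Fin n → Bool) → ∃ λ (e : Fin (sum (indicator ∘ q)) → Fin n) →
  (∀ {a b} → e a ≡ e b → a ≡ b) × (∀ a → q (e a) ≡ true)
enumerate {zero}  q = (λ ()) , (λ { {()} }) , λ ()
enumerate {suc n} q with enumerate (q ∘ suc) | q zero in q₀
... | e , inj , q-true | false = suc ∘ e , inj ∘ sucF-injective , q-true
... | e , inj , q-true | true  = zero ∷ (suc ∘ e) , inj′ , λ { zero → q₀ ; (suc a) → q-true a }
  where
  inj′ : ∀ {a b} → (zero ∷ (suc ∘ e)) a ≡ (zero ∷ (suc ∘ e)) b → a ≡ b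
  inj′ {zero}  {zero}  _  = refl
  inj′ {zero}  {suc b} ()
  inj′ {suc a} {zero}  ()
  inj′ {suc a} {suc b} eq = cong suc (inj (sucF-injective eq))

count : ∀ {n} → (Fin n → Bool) → ℕ
count f = sum (indicator ∘ f)

-- Sequences of rationals

halve : ∀ ε → 0ℚ ℚ.< ε → ∃ λ δ → 0ℚ ℚ.< δ × δ ℚ.+ δ ≡ ε
halve ε 0<ε = ½ ℚ.* ε
  , subst (ℚ._< ½ ℚ.* ε) (ℚ.*-zeroʳ ½) (ℚ.*-monoʳ-<-pos ½ 0<ε)
  , trans (sym (ℚ.*-distribʳ-+ ε ½ ½)) (ℚ.*-identityˡ ε)

<⇒≱ℚ : ∀ {p q} → p ℚ.< q → ¬ q ℚ.≤ p
<⇒≱ℚ p<q q≤p = ℚ.<-irrefl refl (ℚ.<-≤-trans p<q q≤p)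

Eventually : (ℕ → Set) → Set
Eventually P = ∃ λ N → ∀ n → N ℕ.≤ n → P n

eventually-map : ∀ {P Q : ℕ → Set} → (∀ n → P n → Q n) → Eventually P → Eventually Q
eventually-map f (N , p) = N , λ n N≤n → f n (p n N≤n)

eventually-zip : ∀ {P Q R : ℕ → Set} → (∀ n → P n → Q n → R n) → Eventually P → Eventually Q → Eventually R
eventually-zip f (N , p) (M , q) = N ℕ.⊔ M , λ n N⊔M≤n →
  f n (p n (ℕ.≤-trans (ℕ.m≤m⊔n N M) N⊔M≤n)) (q n (ℕ.≤-trans (ℕ.m≤n⊔m N M) N⊔M≤n))

eventually-extract : ∀ {A : Set} {P : ℕ → Set} → (∀ n → P n → A) → Eventually P → A
eventually-extract f (N , p) = f N (p N ℕ.≤-refl)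

Null : (ℕ → ℚ) → Set
Null s = ∀ ε → 0ℚ ℚ.< ε → Eventually λ n → ∣ s n ∣ ℚ.< ε

-- The positive form of not tending to 0. It excludes `Null`, and for Cauchy sequences its negation
-- implies `Null`, so that being null is ¬¬-stable for them.
Away : (ℕ → ℚ) → Set
Away s = ∃ λ δ → 0ℚ ℚ.< δ × Eventually λ n → δ ℚ.≤ ∣ s n ∣

null-cong : ∀ {s t} → (∀ n → s n ≡ t n) → Null s → Null t
null-cong s≡t s₀ ε 0<ε = eventually-map (λ n → subst (λ q → ∣ q ∣ ℚ.< ε) (s≡t n)) (s₀ ε 0<ε)

null-0 : Null λ _ → 0ℚ
null-0 ε 0<ε = 0 , λ _ _ → 0<ε

null-+ : ∀ {s t} → Null s → Null t → Null λ n → s n ℚ.+ t n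
null-+ {s} {t} s₀ t₀ ε 0<ε with halve ε 0<ε
... | δ , 0<δ , refl = eventually-zip
  (λ n s<δ t<δ → ℚ.≤-<-trans (ℚ.∣p+q∣≤∣p∣+∣q∣ (s n) (t n)) (ℚ.+-mono-< s<δ t<δ)) (s₀ δ 0<δ) (t₀ δ 0<δ)

null-neg : ∀ {s} → Null s → Null λ n → ℚ.- s n
null-neg {s} s₀ ε 0<ε = eventually-map (λ n → subst (ℚ._< ε) (sym (ℚ.∣-p∣≡∣p∣ (s n)))) (s₀ ε 0<ε)

Bounded : (ℕ → ℚ) → Set
Bounded s = ∃ λ B → 0ℚ ℚ.< B × Eventually λ n → ∣ s n ∣ ℚ.≤ B

∣p∣≤∣p-q∣+∣q∣ : ∀ p q → ∣ p ∣ ℚ.≤ ∣ p ℚ.- q ∣ ℚ.+ ∣ q ∣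
∣p∣≤∣p-q∣+∣q∣ p q = subst (λ r → ∣ r ∣ ℚ.≤ ∣ p ℚ.- q ∣ ℚ.+ ∣ q ∣)
  (solve 2 (λ p q → (p :- q) :+ q := p) refl p q) (ℚ.∣p+q∣≤∣p∣+∣q∣ (p ℚ.- q) q)
  where open ℚ-Solver

cauchy⇒bounded : ∀ {s} → IsCauchy s → Bounded s
cauchy⇒bounded {s} cs with cs 1ℚ (ℚ.positive⁻¹ 1ℚ)
... | N , close = 1ℚ ℚ.+ ∣ s N ∣ , ℚ.+-mono-<-≤ (ℚ.positive⁻¹ 1ℚ) (ℚ.0≤∣p∣ (s N)) , N , λ n N≤n →
  ℚ.≤-trans (∣p∣≤∣p-q∣+∣q∣ (s n) (s N)) (ℚ.+-monoˡ-≤ ∣ s N ∣ (ℚ.<⇒≤ (close n N N≤n ℕ.≤-refl)))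

null-* : ∀ {s t} → Bounded s → Null t → Null λ n → s n ℚ.* t n
null-* {s} {t} (B , 0<B , s≤B) t₀ ε 0<ε = eventually-zip small s≤B (t₀ (i ℚ.* ε) 0<iε)
  where
  instance
    posB : Positive B
    posB = positive 0<B
    nonZeroB : ℚ.NonZero B
    nonZeroB = ℚ.pos⇒nonZero B
  i : ℚ
  i = 1/ B
  0<iε : 0ℚ ℚ.< i ℚ.* ε
  0<iε = subst (ℚ._< i ℚ.* ε) (ℚ.*-zeroʳ i) (ℚ.*-monoʳ-<-pos i {{ℚ.1/pos⇒pos B}} 0<ε)
  open ℚ.≤-Reasoning
  small : ∀ n → ∣ s n ∣ ℚ.≤ B → ∣ t n ∣ ℚ.< i ℚ.* ε → ∣ s n ℚ.* t n ∣ ℚ.< ε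
  small n s≤B t<iε = begin-strict
    ∣ s n ℚ.* t n ∣       ≡⟨ ℚ.∣p*q∣≡∣p∣*∣q∣ (s n) (t n) ⟩
    ∣ s n ∣ ℚ.* ∣ t n ∣   ≤⟨ ℚ.*-monoʳ-≤-nonNeg ∣ t n ∣ {{ℚ.∣-∣-nonNeg (t n)}} s≤B ⟩
    B ℚ.* ∣ t n ∣         <⟨ ℚ.*-monoʳ-<-pos B t<iε ⟩
    B ℚ.* (i ℚ.* ε)       ≡⟨ ℚ.*-assoc B i ε ⟨
    B ℚ.* i ℚ.* ε         ≡⟨ cong (ℚ._* ε) (ℚ.*-inverseʳ B) ⟩
    1ℚ ℚ.* ε              ≡⟨ ℚ.*-identityˡ ε ⟩
    ε                     ∎

away⇒¬null : ∀ {s} → Away s → ¬ Null s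
away⇒¬null (δ , 0<δ , δ≤s) s₀ =
  eventually-extract (λ n (p : _ × _) → <⇒≱ℚ (proj₂ p) (proj₁ p)) (eventually-zip (λ n → _,_) δ≤s (s₀ δ 0<δ))

away-* : ∀ {s t} → Away s → Away t → Away λ n → s n ℚ.* t n
away-* {s} {t} (δ , 0<δ , δ≤s) (η , 0<η , η≤t) = δ ℚ.* η
  , subst (ℚ._< δ ℚ.* η) (ℚ.*-zeroʳ δ) (ℚ.*-monoʳ-<-pos δ {{positive 0<δ}} 0<η)
  , eventually-zip large δ≤s η≤t
  where
  open ℚ.≤-Reasoning
  large : ∀ n → δ ℚ.≤ ∣ s n ∣ → η ℚ.≤ ∣ t n ∣ → δ ℚ.* η ℚ.≤ ∣ s n ℚ.* t n ∣
  large n δ≤s η≤t = begin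
    δ ℚ.* η             ≤⟨ ℚ.*-monoˡ-≤-nonNeg δ {{nonNegative (ℚ.<⇒≤ 0<δ)}} η≤t ⟩
    δ ℚ.* ∣ t n ∣       ≤⟨ ℚ.*-monoʳ-≤-nonNeg ∣ t n ∣ {{ℚ.∣-∣-nonNeg (t n)}} δ≤s ⟩
    ∣ s n ∣ ℚ.* ∣ t n ∣ ≡⟨ ℚ.∣p*q∣≡∣p∣*∣q∣ (s n) (t n) ⟨
    ∣ s n ℚ.* t n ∣     ∎

p+r<q+r⇒p<q : ∀ r {p q} → p ℚ.+ r ℚ.< q ℚ.+ r → p ℚ.< q
p+r<q+r⇒p<q r {p} {q} p+r<q+r = ℚ.≰⇒> λ q≤p → <⇒≱ℚ p+r<q+r (ℚ.+-monoˡ-≤ r q≤p)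

-- Whether |s N| is below ε/2 decides which of the two alternatives holds.
¬away⇒null : ∀ {s} → IsCauchy s → ¬ Away s → Null s
¬away⇒null {s} cs ¬away ε 0<ε with halve ε 0<ε
... | η , 0<η , refl with halve η 0<η
...   | δ , 0<δ , refl with cs δ 0<δ
...     | N , close with ∣ s N ∣ ℚ.<? δ ℚ.+ δ
...       | yes sN<2δ = N , λ n N≤n → ℚ.≤-<-trans (∣p∣≤∣p-q∣+∣q∣ (s n) (s N))
              (ℚ.+-mono-< (ℚ.<-trans (close n N N≤n ℕ.≤-refl) δ<δ+δ) sN<2δ)
            where
            δ<δ+δ : δ ℚ.< δ ℚ.+ δ
            δ<δ+δ = subst (ℚ._< δ ℚ.+ δ) (ℚ.+-identityˡ δ) (ℚ.+-monoˡ-< δ 0<δ)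
...       | no  sN≮2δ = contradiction (δ , 0<δ , N , large) ¬away
            where
            large : ∀ n → N ℕ.≤ n → δ ℚ.≤ ∣ s n ∣
            large n N≤n = ℚ.<⇒≤ (p+r<q+r⇒p<q δ (ℚ.≤-<-trans (ℚ.≮⇒≥ sN≮2δ)
              (ℚ.≤-<-trans (∣p∣≤∣p-q∣+∣q∣ (s N) (s n))
                (subst (ℚ._< ∣ s n ∣ ℚ.+ δ) (ℚ.+-comm ∣ s n ∣ ∣ s N ℚ.- s n ∣)
                  (ℚ.+-monoʳ-< ∣ s n ∣ (close N n ℕ.≤-refl N≤n))))))

-- The real numbers as a commutative ring

≗⇒≃ : ∀ {x y} → (∀ n → seq x n ≡ seq y n) → x ≃ y
≗⇒≃ {x} {y} x≡y = null-cong
  (λ n → sym (trans (cong (ℚ._- seq y n) (x≡y n)) (ℚ.+-inverseʳ (seq y n)))) null-0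

≃-refl : ∀ {x} → x ≃ x
≃-refl {x} = ≗⇒≃ {x} {x} λ n → refl

≃-sym : ∀ {x y} → x ≃ y → y ≃ x
≃-sym {x} {y} x≃y = null-cong
  (λ n → solve 2 (λ x y → :- (x :- y) := y :- x) refl (seq x n) (seq y n)) (null-neg x≃y)
  where open ℚ-Solver

≃-trans : ∀ {x y z} → x ≃ y → y ≃ z → x ≃ z
≃-trans {x} {y} {z} x≃y y≃z = null-cong
  (λ n → solve 3 (λ x y z → (x :- y) :+ (y :- z) := x :- z) refl (seq x n) (seq y n) (seq z n)) (null-+ x≃y y≃z)
  where open ℚ-Solver

1ᴿ : ℝ
1ᴿ = fromℚ 1ℚ

-- Written as a product so that the Cauchy property and the congruence come from multiplication.
-ᴿ_ : ℝ → ℝ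
-ᴿ x = fromℚ (ℚ.- 1ℚ) *ᴿ x

+ᴿ-cong : ∀ {x x′ y y′} → x ≃ x′ → y ≃ y′ → x +ᴿ y ≃ x′ +ᴿ y′
+ᴿ-cong {x} {x′} {y} {y′} x≃x′ y≃y′ = null-cong
  (λ n → solve 4 (λ x x′ y y′ → (x :- x′) :+ (y :- y′) := (x :+ y) :- (x′ :+ y′)) refl
           (seq x n) (seq x′ n) (seq y n) (seq y′ n))
  (null-+ x≃x′ y≃y′)
  where open ℚ-Solver

-- The difference of the products is x (y - y′) + y′ (x - x′), and a bounded sequence times a null
-- one is null.
*ᴿ-cong : ∀ {x x′ y y′} → x ≃ x′ → y ≃ y′ → x *ᴿ y ≃ x′ *ᴿ y′
*ᴿ-cong {x} {x′} {y} {y′} x≃x′ y≃y′ = null-cong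
  (λ n → solve 4 (λ x x′ y y′ → x :* (y :- y′) :+ y′ :* (x :- x′) := x :* y :- x′ :* y′) refl
           (seq x n) (seq x′ n) (seq y n) (seq y′ n))
  (null-+ {λ n → seq x n ℚ.* (seq y n ℚ.- seq y′ n)} {λ n → seq y′ n ℚ.* (seq x n ℚ.- seq x′ n)}
    (null-* {seq x} (cauchy⇒bounded {seq x} (cauchy x)) y≃y′)
    (null-* {seq y′} (cauchy⇒bounded {seq y′} (cauchy y′)) x≃x′))
  where open ℚ-Solver

ℝ-commutativeRing : CommutativeRing 0ℓ 0ℓ
ℝ-commutativeRing = record
  { Carrier = ℝ
  ; _≈_ = _≃_
  ; _+_ = _+ᴿ_
  ; _*_ = _*ᴿ_
  ; -_ = -ᴿ_
  ; 0# = 0ᴿ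
  ; 1# = 1ᴿ
  ; isCommutativeRing = record
    { isRing = record
      { +-isAbelianGroup = record
        { isGroup = record
          { isMonoid = record
            { isSemigroup = record
              { isMagma = record
                { isEquivalence = record
                  { refl  = λ {x} → ≃-refl {x}
                  ; sym   = λ {x} {y} → ≃-sym {x} {y}
                  ; trans = λ {x} {y} {z} → ≃-trans {x} {y} {z}
                  }
                ; ∙-cong = λ {x} {x′} {y} {y′} → +ᴿ-cong {x} {x′} {y} {y′}
                }
              ; assoc = λ x y z → ≗⇒≃ {(x +ᴿ y) +ᴿ z} {x +ᴿ (y +ᴿ z)} λ n → ℚ.+-assoc (seq x n) (seq y n) (seq z n)
              }
            ; identity = (λ x → ≗⇒≃ {0ᴿ +ᴿ x} {x} λ n → ℚ.+-identityˡ (seq x n))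
                       , (λ x → ≗⇒≃ {x +ᴿ 0ᴿ} {x} λ n → ℚ.+-identityʳ (seq x n))
            }
          ; inverse = (λ x → ≗⇒≃ {(-ᴿ x) +ᴿ x} {0ᴿ} λ n → inverseˡ (seq x n))
                    , (λ x → ≗⇒≃ {x +ᴿ (-ᴿ x)} {0ᴿ} λ n → trans (ℚ.+-comm (seq x n) _) (inverseˡ (seq x n)))
          ; ⁻¹-cong = λ {x} {y} → *ᴿ-cong {fromℚ (ℚ.- 1ℚ)} {fromℚ (ℚ.- 1ℚ)} {x} {y} (≃-refl {fromℚ (ℚ.- 1ℚ)})
          }
        ; comm = λ x y → ≗⇒≃ {x +ᴿ y} {y +ᴿ x} λ n → ℚ.+-comm (seq x n) (seq y n)
        }
      ; *-cong = λ {x} {x′} {y} {y′} → *ᴿ-cong {x} {x′} {y} {y′}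
      ; *-assoc = λ x y z → ≗⇒≃ {(x *ᴿ y) *ᴿ z} {x *ᴿ (y *ᴿ z)} λ n → ℚ.*-assoc (seq x n) (seq y n) (seq z n)
      ; *-identity = (λ x → ≗⇒≃ {1ᴿ *ᴿ x} {x} λ n → ℚ.*-identityˡ (seq x n))
                   , (λ x → ≗⇒≃ {x *ᴿ 1ᴿ} {x} λ n → ℚ.*-identityʳ (seq x n))
      ; distrib = (λ x y z → ≗⇒≃ {x *ᴿ (y +ᴿ z)} {x *ᴿ y +ᴿ x *ᴿ z} λ n → ℚ.*-distribˡ-+ (seq x n) (seq y n) (seq z n))
                , (λ x y z → ≗⇒≃ {(y +ᴿ z) *ᴿ x} {y *ᴿ x +ᴿ z *ᴿ x} λ n → ℚ.*-distribʳ-+ (seq x n) (seq y n) (seq z n))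
      }
    ; *-comm = λ x y → ≗⇒≃ {x *ᴿ y} {y *ᴿ x} λ n → ℚ.*-comm (seq x n) (seq y n)
    }
  }
  where
  inverseˡ : ∀ p → ℚ.- 1ℚ ℚ.* p ℚ.+ p ≡ 0ℚ
  inverseˡ = solve 1 (λ p → :- con 1ℚ :* p :+ p := con 0ℚ) refl
    where open ℚ-Solver

module ℝ-Ring = CommutativeRing ℝ-commutativeRing

≃0⇒null : ∀ {x} → x ≃ 0ᴿ → Null (seq x)
≃0⇒null {x} = null-cong λ n → ℚ.+-identityʳ (seq x n)

null⇒≃0 : ∀ {x} → Null (seq x) → x ≃ 0ᴿ
null⇒≃0 {x} = null-cong λ n → sym (ℚ.+-identityʳ (seq x n))

1≄0 : ¬ 1ᴿ ≃ 0ᴿ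
1≄0 1≃0 = away⇒¬null {λ _ → 1ℚ} (1ℚ , ℚ.positive⁻¹ 1ℚ , 0 , λ _ _ → ℚ.≤-refl {1ℚ}) (≃0⇒null {1ᴿ} 1≃0)

-- Being ≃ 0 is ¬¬-stable, so x ≄ 0 may be used without a bound that keeps x away from 0.
*ᴿ-cancelˡ-0 : ∀ {x y} → ¬ x ≃ 0ᴿ → x *ᴿ y ≃ 0ᴿ → y ≃ 0ᴿ
*ᴿ-cancelˡ-0 {x} {y} x≄0 xy≃0 = null⇒≃0 {y} (¬away⇒null (cauchy y) λ y-away →
  x≄0 (null⇒≃0 {x} (¬away⇒null (cauchy x) λ x-away →
    away⇒¬null (away-* x-away y-away) (≃0⇒null {x *ᴿ y} xy≃0))))

-- The order on the real numbers

p≤∣p∣ : ∀ p → p ℚ.≤ ∣ p ∣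
p≤∣p∣ p with ℚ.≤-total 0ℚ p
... | inj₁ 0≤p = ℚ.≤-reflexive (sym (ℚ.0≤p⇒∣p∣≡p 0≤p))
... | inj₂ p≤0 = ℚ.≤-trans p≤0 (ℚ.0≤∣p∣ p)

p-q<r⇒p<q+r : ∀ {p q r} → p ℚ.- q ℚ.< r → p ℚ.< q ℚ.+ r
p-q<r⇒p<q+r {p} {q} {r} p-q<r = subst (ℚ._< q ℚ.+ r)
  (solve 2 (λ p q → q :+ (p :- q) := p) refl p q) (ℚ.+-monoʳ-< q p-q<r)
  where open ℚ-Solver

p<q+r⇒p-q<r : ∀ {p q r} → p ℚ.< q ℚ.+ r → p ℚ.- q ℚ.< r
p<q+r⇒p-q<r {p} {q} {r} p<q+r = subst (p ℚ.- q ℚ.<_)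
  (solve 2 (λ q r → (q :+ r) :- q := r) refl q r) (ℚ.+-monoˡ-< (ℚ.- q) p<q+r)
  where open ℚ-Solver

≤ᴿ-reflexive : ∀ {x y} → x ≃ y → x ≤ᴿ y
≤ᴿ-reflexive {x} {y} x≃y ε 0<ε = eventually-map
  (λ n → λ <ε → p-q<r⇒p<q+r (ℚ.≤-<-trans (p≤∣p∣ (seq x n ℚ.- seq y n)) <ε)) (x≃y ε 0<ε)

≤ᴿ-refl : ∀ {x} → x ≤ᴿ x
≤ᴿ-refl {x} = ≤ᴿ-reflexive {x} {x} (≃-refl {x})

≤ᴿ-trans : ∀ {x y z} → x ≤ᴿ y → y ≤ᴿ z → x ≤ᴿ z
≤ᴿ-trans {x} {y} {z} x≤y y≤z ε 0<ε with halve ε 0<ε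
... | δ , 0<δ , refl = eventually-zip
  (λ n x<y+δ y<z+δ → subst (seq x n ℚ.<_) (ℚ.+-assoc (seq z n) δ δ) (ℚ.<-trans x<y+δ (ℚ.+-monoˡ-< δ y<z+δ)))
  (x≤y δ 0<δ) (y≤z δ 0<δ)

≤ᴿ-antisym : ∀ {x y} → x ≤ᴿ y → y ≤ᴿ x → x ≃ y
≤ᴿ-antisym {x} {y} x≤y y≤x ε 0<ε = eventually-zip (λ n → close (seq x n) (seq y n)) (x≤y ε 0<ε) (y≤x ε 0<ε)
  where
  open ℚ-Solver
  close : ∀ p q → p ℚ.< q ℚ.+ ε → q ℚ.< p ℚ.+ ε → ∣ p ℚ.- q ∣ ℚ.< ε
  close p q p<q+ε q<p+ε with ℚ.∣p∣≡p∨∣p∣≡-p (p ℚ.- q)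
  ... | inj₁ ≡p-q  = subst (ℚ._< ε) (sym ≡p-q) (p<q+r⇒p-q<r p<q+ε)
  ... | inj₂ ≡-p-q = subst (ℚ._< ε)
        (sym (trans ≡-p-q (solve 2 (λ p q → :- (p :- q) := q :- p) refl p q))) (p<q+r⇒p-q<r q<p+ε)

-- From some N on, x - y varies by less than δ = ε/2. If y - x is below δ at N, it stays below ε.
-- Otherwise x - y is negative from N on, which would give x ≤ y.
≰ᴿ⇒≥ᴿ : ∀ {x y} → ¬ x ≤ᴿ y → y ≤ᴿ x
≰ᴿ⇒≥ᴿ {x} {y} x≰y ε 0<ε with halve ε 0<ε
... | δ , 0<δ , refl with cauchy (x +ᴿ (-ᴿ y)) δ 0<δ
...   | N , close with (seq y N ℚ.- seq x N) ℚ.<? δ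
...     | yes y-x<δ = N , λ n N≤n → p-q<r⇒p<q+r (ℚ.≤-<-trans (ℚ.≤-reflexive (split (seq x n) (seq y n) (seq x N) (seq y N)))
            (ℚ.+-mono-< (ℚ.≤-<-trans (p≤∣p∣ _) (close N n ℕ.≤-refl N≤n)) y-x<δ))
  where
  open ℚ-Solver
  split : ∀ x y x′ y′ → y ℚ.- x ≡ ((x′ ℚ.+ ℚ.- 1ℚ ℚ.* y′) ℚ.- (x ℚ.+ ℚ.- 1ℚ ℚ.* y)) ℚ.+ (y′ ℚ.- x′)
  split = solve 4 (λ x y x′ y′ → y :- x
    := ((x′ :+ :- con 1ℚ :* y′) :- (x :+ :- con 1ℚ :* y)) :+ (y′ :- x′)) refl
...     | no  y-x≮δ = contradiction x≤y x≰y
  where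
  open ℚ-Solver
  split : ∀ x y x′ y′ → (x ℚ.- y) ℚ.+ (y′ ℚ.- x′) ≡ (x ℚ.+ ℚ.- 1ℚ ℚ.* y) ℚ.- (x′ ℚ.+ ℚ.- 1ℚ ℚ.* y′)
  split = solve 4 (λ x y x′ y′ → (x :- y) :+ (y′ :- x′)
    := (x :+ :- con 1ℚ :* y) :- (x′ :+ :- con 1ℚ :* y′)) refl
  x-y<0 : ∀ n → N ℕ.≤ n → seq x n ℚ.- seq y n ℚ.< 0ℚ
  x-y<0 n N≤n = p+r<q+r⇒p<q δ (subst ((seq x n ℚ.- seq y n) ℚ.+ δ ℚ.<_) (sym (ℚ.+-identityˡ δ))
    (ℚ.≤-<-trans (ℚ.+-monoʳ-≤ (seq x n ℚ.- seq y n) (ℚ.≮⇒≥ y-x≮δ))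
      (ℚ.≤-<-trans (ℚ.≤-reflexive (split (seq x n) (seq y n) (seq x N) (seq y N)))
        (ℚ.≤-<-trans (p≤∣p∣ _) (close n N N≤n ℕ.≤-refl)))))
  x≤y : x ≤ᴿ y
  x≤y η 0<η = N , λ n N≤n → p-q<r⇒p<q+r (ℚ.<-trans (x-y<0 n N≤n) 0<η)

fromℚ-mono-≤ : ∀ {p q} → p ℚ.≤ q → fromℚ p ≤ᴿ fromℚ q
fromℚ-mono-≤ {p} {q} p≤q ε 0<ε = 0 , λ _ _ → subst (ℚ._< q ℚ.+ ε) (ℚ.+-identityʳ p) (ℚ.+-mono-≤-< p≤q 0<ε)

fromℚ-cancel-≤ : ∀ {p q} → fromℚ p ≤ᴿ fromℚ q → p ℚ.≤ q
fromℚ-cancel-≤ {p} {q} p≤q = ℚ.≮⇒≥ λ q<p → eventually-extract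
  (λ n p<q+[p-q] → ℚ.<-irrefl refl (subst (p ℚ.<_) (solve 2 (λ p q → q :+ (p :- q) := p) refl p q) p<q+[p-q]))
  -- The tolerance p - q turns the estimate into p < p.
  (p≤q (p ℚ.- q) (subst (ℚ._< p ℚ.- q) (ℚ.+-inverseʳ q) (ℚ.+-monoˡ-< (ℚ.- q) q<p)))
  where open ℚ-Solver

-- Linear dependence

-- The search for a pivot: whether a real entry is zero cannot be decided, so the alternative is
-- available only under double negation.
¬¬-all-or-counterexample : ∀ {n p} (P : Fin n → Set p) → ¬ ¬ ((∀ i → P i) ⊎ ∃ λ i → ¬ P i)
¬¬-all-or-counterexample {zero}  P k = k (inj₁ λ ())
¬¬-all-or-counterexample {suc n} P k = ¬¬-excluded-middle λ where
  (no ¬p) → k (inj₂ (zero , ¬p))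
  (yes p) → ¬¬-all-or-counterexample (P ∘ suc) λ where
    (inj₁ all)      → k (inj₁ λ { zero → p ; (suc i) → all i })
    (inj₂ (i , ¬p)) → k (inj₂ (suc i , ¬p))

module LinearDependence {c ℓ} (R : CommutativeRing c ℓ) where

  open CommutativeRing R hiding (refl; zero)
    renaming (trans to ≈-trans; sym to ≈-sym; reflexive to ≈-reflexive)
  open Algebra.Properties.Ring ring using (-‿distribˡ-*; -‿distribʳ-*)
  open Algebra.Properties.Semiring.Sum semiring
    using (sum-cong-≋; sum-remove; ∑-distrib-+; *-distribˡ-sum) renaming (sum to ∑ᴿ)
  open Relation.Binary.Reasoning.Setoid setoid

  private
    variable
      k n : ℕ

  Kernel : (Fin k → Bool) → (Fin k → Vector Carrier n) → Vector Carrier n → Set ℓ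
  Kernel f A x = ∀ i → f i ≡ true → ∑ᴿ (λ j → A i j * x j) ≈ 0#

  -- Fraction-free elimination of the column p with pivot a p.
  module _ (a : Vector Carrier (suc n)) (p : Fin (suc n)) where

    eliminate : Vector Carrier (suc n) → Vector Carrier n
    eliminate b j = b (punchIn p j) * a p + - (b p) * a (punchIn p j)

    a′ : Vector Carrier n
    a′ j = a (punchIn p j)

    -- Back substitution multiplied by the pivot: coordinate `p` is chosen to make the row `a`
    -- vanish, and no division occurs.
    extend : Vector Carrier n → Vector Carrier (suc n)
    extend x = insertAt (λ j → a p * x j) p (- ∑ᴿ (λ j → a′ j * x j))

    ∑-extend : ∀ b x → ∑ᴿ (λ j → b j * extend x j) ≈ ∑ᴿ (λ j → eliminate b j * x j)
    ∑-extend b x = begin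
      ∑ᴿ (λ j → b j * extend x j)
        ≈⟨ sum-remove {i = p} (λ j → b j * extend x j) ⟩
      b p * extend x p + ∑ᴿ (λ j → b (punchIn p j) * extend x (punchIn p j))
        ≡⟨ cong (λ e → b p * e + ∑ᴿ (λ j → b (punchIn p j) * extend x (punchIn p j))) (insertAt-lookup (λ j → a p * x j) p _) ⟩
      b p * - ∑ᴿ (λ j → a′ j * x j) + ∑ᴿ (λ j → b (punchIn p j) * extend x (punchIn p j))
        ≈⟨ +-cong head≈ (sum-cong-≋ tail≈) ⟩
      ∑ᴿ (λ j → - b p * a′ j * x j) + ∑ᴿ (λ j → b (punchIn p j) * a p * x j)
        ≈⟨ +-comm _ _ ⟩
      ∑ᴿ (λ j → b (punchIn p j) * a p * x j) + ∑ᴿ (λ j → - b p * a′ j * x j)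
        ≈⟨ ∑-distrib-+ (λ j → b (punchIn p j) * a p * x j) (λ j → - b p * a′ j * x j) ⟨
      ∑ᴿ (λ j → b (punchIn p j) * a p * x j + - b p * a′ j * x j)
        ≈⟨ sum-cong-≋ (λ j → distribʳ (x j) (b (punchIn p j) * a p) (- b p * a′ j)) ⟨
      ∑ᴿ (λ j → eliminate b j * x j) ∎
      where
      head≈ : b p * - ∑ᴿ (λ j → a′ j * x j) ≈ ∑ᴿ (λ j → - b p * a′ j * x j)
      head≈ = begin
        b p * - ∑ᴿ (λ j → a′ j * x j)       ≈⟨ -‿distribʳ-* (b p) _ ⟨
        - (b p * ∑ᴿ (λ j → a′ j * x j))     ≈⟨ -‿distribˡ-* (b p) _ ⟩
        - b p * ∑ᴿ (λ j → a′ j * x j)       ≈⟨ *-distribˡ-sum (- b p) (λ j → a′ j * x j) ⟩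
        ∑ᴿ (λ j → - b p * (a′ j * x j))     ≈⟨ sum-cong-≋ (λ j → *-assoc (- b p) (a′ j) (x j)) ⟨
        ∑ᴿ (λ j → - b p * a′ j * x j)       ∎
      tail≈ : ∀ j → b (punchIn p j) * extend x (punchIn p j) ≈ b (punchIn p j) * a p * x j
      tail≈ j = begin
        b (punchIn p j) * extend x (punchIn p j) ≡⟨ cong (b (punchIn p j) *_) (insertAt-punchIn (λ j → a p * x j) p _ j) ⟩
        b (punchIn p j) * (a p * x j)            ≈⟨ *-assoc (b (punchIn p j)) (a p) (x j) ⟨
        b (punchIn p j) * a p * x j              ∎

    ∑-extend-pivot : ∀ x → ∑ᴿ (λ j → a j * extend x j) ≈ 0#
    ∑-extend-pivot x = begin
      ∑ᴿ (λ j → a j * extend x j)                       ≈⟨ ∑-extend a x ⟩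
      ∑ᴿ (λ j → (a′ j * a p + - a p * a′ j) * x j)      ≈⟨ sum-cong-≋ vanishes ⟩
      ∑ᴿ {n} (λ j → 0# * 0#)                            ≈⟨ *-distribˡ-sum {n} 0# (λ j → 0#) ⟨
      0# * ∑ᴿ {n} (λ j → 0#)                            ≈⟨ zeroˡ _ ⟩
      0#                                                ∎
      where
      vanishes : ∀ j → (a′ j * a p + - a p * a′ j) * x j ≈ 0# * 0#
      vanishes j = begin
        (a′ j * a p + - a p * a′ j) * x j    ≈⟨ *-congʳ (+-cong (*-comm (a′ j) (a p)) (≈-sym (-‿distribˡ-* (a p) (a′ j)))) ⟩
        (a p * a′ j + - (a p * a′ j)) * x j  ≈⟨ *-congʳ (-‿inverseʳ (a p * a′ j)) ⟩
        0# * x j                             ≈⟨ zeroˡ (x j) ⟩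
        0#                                   ≈⟨ zeroˡ 0# ⟨
        0# * 0#                              ∎

  -- Only the rows marked by f count as equations.
  module _ (1≉0 : ¬ 1# ≈ 0#) (cancel : ∀ {x y} → ¬ x ≈ 0# → x * y ≈ 0# → y ≈ 0#) where

    -- Gaussian elimination by induction on the rows. An unmarked row is skipped and a zero row
    -- dropped; any other row has a pivot, which removes one equation and one unknown.
    ¬¬-dependent : (f : Fin k → Bool) (A : Fin k → Vector Carrier n) → count f ℕ.< n →
      ¬ ¬ (∃ λ x → Kernel f A x × ∃ λ j → ¬ x j ≈ 0#)
    ¬¬-dependent {k = zero}  {suc n} f A _ ret = ret (const 1# , (λ ()) , zero , 1≉0)
    ¬¬-dependent {k = suc k} {n} f A f<n ret with f zero in f₀
    ... | false = ¬¬-dependent (f ∘ suc) (A ∘ suc) f<n λ (x , kernel , nonzero) →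
          ret (x , (λ { zero f₀≡true → contradiction (trans (sym f₀) f₀≡true) λ () ; (suc i) → kernel i }) , nonzero)
    ¬¬-dependent {k = suc k} {suc n} f A (s≤s f<n) ret | true =
      ¬¬-all-or-counterexample (λ j → A zero j ≈ 0#) λ where
        (inj₁ A₀≈0) → ¬¬-dependent (f ∘ suc) (A ∘ suc) (ℕ.m<n⇒m<1+n f<n) λ (x , kernel , nonzero) →
          ret (x , (λ { zero _ → zero-row A₀≈0 x ; (suc i) → kernel i }) , nonzero)
        (inj₂ (p , Ap≉0)) → ¬¬-dependent (f ∘ suc) (λ i → eliminate (A zero) p (A (suc i))) f<n
          λ (x , kernel , j , xj≉0) → ret (extend (A zero) p x
            , (λ { zero _     → ∑-extend-pivot (A zero) p x
                 ; (suc i) fi → ≈-trans (∑-extend (A zero) p (A (suc i)) x) (kernel i fi) })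
            , punchIn p j
            -- `extend` has multiplied the nonzero coordinate by the pivot, which `cancel` removes.
            , λ ≈0 → xj≉0 (cancel Ap≉0 (≈-trans (≈-reflexive (sym (insertAt-punchIn (λ j → A zero p * x j) p _ j))) ≈0)))
      where
      zero-row : (∀ j → A zero j ≈ 0#) → ∀ x → ∑ᴿ (λ j → A zero j * x j) ≈ 0#
      zero-row A₀≈0 x = begin
        ∑ᴿ (λ j → A zero j * x j)     ≈⟨ sum-cong-≋ (λ j → ≈-trans (*-congʳ (A₀≈0 j)) (≈-trans (zeroˡ (x j)) (≈-sym (zeroˡ 0#)))) ⟩
        ∑ᴿ {suc n} (λ j → 0# * 0#)    ≈⟨ *-distribˡ-sum {suc n} 0# (λ j → 0#) ⟨
        0# * ∑ᴿ {suc n} (λ j → 0#)    ≈⟨ zeroˡ _ ⟩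
        0#                            ∎

-- Dimension of boxes

open LinearDependence ℝ-commutativeRing using (¬¬-dependent)
module ℝ-Sum = Algebra.Properties.Semiring.Sum ℝ-Ring.semiring
open Algebra.Properties.Group ℝ-Ring.+-group using (x∙y⁻¹≈ε⇒x≈y)

Between : ∀ {d} → Point d → Point d → Pred (Point d) 0ℓ
Between lo hi x = ∀ j → lo j ≤ᴿ x j × x j ≤ᴿ hi j

-- The coordinates marked by thick are those in which the box has positive length.
record Shape {d} (lo hi : Point d) (thick : Fin d → Bool) : Set where
  field
    lo≤hi : ∀ j → lo j ≤ᴿ hi j
    hi≰lo : ∀ j → thick j ≡ true → ¬ hi j ≤ᴿ lo j
    hi≤lo : ∀ j → thick j ≡ false → hi j ≤ᴿ lo j

open Shape

tailShape : ∀ {d} {lo hi : Point (suc d)} {thick} → Shape lo hi thick →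
  Shape (tail lo) (tail hi) (thick ∘ suc)
tailShape sh = record { lo≤hi = lo≤hi sh ∘ suc ; hi≰lo = hi≰lo sh ∘ suc ; hi≤lo = hi≤lo sh ∘ suc }

x≃0⇒x+y≃0⇒y≃0 : ∀ x y → x ≃ 0ᴿ → x +ᴿ y ≃ 0ᴿ → y ≃ 0ᴿ
x≃0⇒x+y≃0⇒y≃0 x y x≃0 x+y≃0 = begin
  y        ≈⟨ +-identityˡ y ⟨
  0ᴿ +ᴿ y  ≈⟨ +-congʳ {y} {x} {0ᴿ} x≃0 ⟨
  x +ᴿ y   ≈⟨ x+y≃0 ⟩
  0ᴿ       ∎
  where
  open ℝ-Ring using (setoid; +-identityˡ; +-congʳ)
  open Relation.Binary.Reasoning.Setoid setoid

-- The points `q` are placed at height l, and one of them again at height h. In the new coordinate,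
-- subtracting l times the relation `∑ c ≃ 0ᴿ` leaves (h - l) c₀ ≃ 0. Hence c₀ ≃ 0, and what remains
-- is a relation among the `q`.
affinelyIndependent-cons : ∀ {d n l h} {q : Fin (suc n) → Point d} → ¬ h ≃ l → AffinelyIndependent q →
  AffinelyIndependent ((h ∷ q zero) ∷ λ i → l ∷ q i)
affinelyIndependent-cons {d} {n} {l} {h} {q} h≄l q-independent c ∑c≃0 ∑cp≃0 = λ where
    zero    → c₀≃0
    (suc i) → q-independent (tail c)
      (x≃0⇒x+y≃0⇒y≃0 (c zero) (∑ (tail c)) c₀≃0 ∑c≃0)
      (λ j → x≃0⇒x+y≃0⇒y≃0 (c zero *ᴿ q zero j) (∑ λ i → c (suc i) *ᴿ q i j)
               (ℝ-Ring.trans {c zero *ᴿ q zero j} {0ᴿ *ᴿ q zero j} {0ᴿ}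
                 (ℝ-Ring.*-congʳ {q zero j} {c zero} {0ᴿ} c₀≃0) (ℝ-Ring.zeroˡ (q zero j)))
               (∑cp≃0 (suc j)))
      i
  where
  open ℝ-Ring using (setoid; +-cong; +-congˡ; *-congˡ; zeroʳ; +-identityˡ)
  open Relation.Binary.Reasoning.Setoid setoid
  S : ℝ
  S = ∑ (tail c)
  [h-l]c₀≃0 : (h +ᴿ (-ᴿ l)) *ᴿ c zero ≃ 0ᴿ
  [h-l]c₀≃0 = begin
    (h +ᴿ (-ᴿ l)) *ᴿ c zero
      ≈⟨ ≗⇒≃ {(h +ᴿ (-ᴿ l)) *ᴿ c zero} {(c zero *ᴿ h +ᴿ S *ᴿ l) +ᴿ (-ᴿ l) *ᴿ (c zero +ᴿ S)}
           (λ n → rearrange (seq h n) (seq l n) (seq (c zero) n) (seq S n)) ⟩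
    (c zero *ᴿ h +ᴿ S *ᴿ l) +ᴿ (-ᴿ l) *ᴿ (c zero +ᴿ S)
      ≈⟨ +-cong {c zero *ᴿ h +ᴿ S *ᴿ l} {c zero *ᴿ h +ᴿ (∑ λ i → c (suc i) *ᴿ l)} {(-ᴿ l) *ᴿ (c zero +ᴿ S)} {(-ᴿ l) *ᴿ 0ᴿ}
           (+-congˡ {c zero *ᴿ h} {S *ᴿ l} {∑ λ i → c (suc i) *ᴿ l} (ℝ-Sum.*-distribʳ-sum l (tail c)))
           (*-congˡ { -ᴿ l} {c zero +ᴿ S} {0ᴿ} ∑c≃0) ⟩
    (c zero *ᴿ h +ᴿ (∑ λ i → c (suc i) *ᴿ l)) +ᴿ (-ᴿ l) *ᴿ 0ᴿ
      ≈⟨ +-cong {c zero *ᴿ h +ᴿ (∑ λ i → c (suc i) *ᴿ l)} {0ᴿ} {(-ᴿ l) *ᴿ 0ᴿ} {0ᴿ} (∑cp≃0 zero) (zeroʳ (-ᴿ l)) ⟩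
    0ᴿ +ᴿ 0ᴿ
      ≈⟨ +-identityˡ 0ᴿ ⟩
    0ᴿ ∎
    where
    open ℚ-Solver
    rearrange : ∀ h l c s → (h ℚ.+ ℚ.- 1ℚ ℚ.* l) ℚ.* c ≡ (c ℚ.* h ℚ.+ s ℚ.* l) ℚ.+ (ℚ.- 1ℚ ℚ.* l) ℚ.* (c ℚ.+ s)
    rearrange = solve 4 (λ h l c s → (h :+ :- con 1ℚ :* l) :* c
      := (c :* h :+ s :* l) :+ (:- con 1ℚ :* l) :* (c :+ s)) refl
  c₀≃0 : c zero ≃ 0ᴿ
  c₀≃0 = *ᴿ-cancelˡ-0 {h +ᴿ (-ᴿ l)} {c zero} (λ h-l≃0 → h≄l (x∙y⁻¹≈ε⇒x≈y h l h-l≃0)) [h-l]c₀≃0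

-- Induction on the coordinates: a thin one is filled in with its lower end, a thick one adds one
-- more point at its upper end.
affinelyIndependentPoints : ∀ {d} {lo hi : Point d} {thick} → Shape lo hi thick →
  ∃ λ (p : Fin (suc (count thick)) → Point d) → (∀ i → p i ∈ Between lo hi) × AffinelyIndependent p
affinelyIndependentPoints {zero} sh = const [] , (λ i ()) ,
  λ { c ∑c≃0 _ zero → ℝ-Ring.trans {c zero} {c zero +ᴿ 0ᴿ} {0ᴿ}
        (ℝ-Ring.sym {c zero +ᴿ 0ᴿ} {c zero} (ℝ-Ring.+-identityʳ (c zero))) ∑c≃0 }
affinelyIndependentPoints {suc d} {lo} {hi} {thick} sh
  with affinelyIndependentPoints (tailShape sh) | thick zero in eq
... | q , q-between , q-independent | false = (λ i → lo zero ∷ q i)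
    , (λ { i zero → ≤ᴿ-refl {lo zero} , lo≤hi sh zero ; i (suc j) → q-between i j })
    , λ c ∑c≃0 ∑cp≃0 → q-independent c ∑c≃0 (∑cp≃0 ∘ suc)
... | q , q-between , q-independent | true = (hi zero ∷ q zero) ∷ (λ i → lo zero ∷ q i)
    , (λ { zero    zero    → lo≤hi sh zero , ≤ᴿ-refl {hi zero}
         ; zero    (suc j) → q-between zero j
         ; (suc i) zero    → ≤ᴿ-refl {lo zero} , lo≤hi sh zero
         ; (suc i) (suc j) → q-between i j })
    , affinelyIndependent-cons {q = q} (λ hi≃lo → hi≰lo sh zero eq (≤ᴿ-reflexive {hi zero} {lo zero} hi≃lo)) q-independent

-- In a thin coordinate all points agree, so its equation follows from `∑ c ≃ 0ᴿ`. This leaves 1 +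
-- `count thick` equations for n + 1 coefficients, and more unknowns than equations would force a
-- dependence.
affinelyIndependent⇒≤ : ∀ {d n} {lo hi : Point d} {thick} → Shape lo hi thick →
  (p : Fin (suc n) → Point d) → (∀ i → p i ∈ Between lo hi) → AffinelyIndependent p → n ℕ.≤ count thick
affinelyIndependent⇒≤ {d} {n} {lo} {hi} {thick} sh p p-between p-independent =
  decidable-stable (n ℕ.≤? count thick) λ n≰e →
    -- The additional first row consists of ones and stands for `∑ c ≃ 0ᴿ`.
    ¬¬-dependent 1≄0 (λ {x} {y} → *ᴿ-cancelˡ-0 {x} {y}) (true ∷ thick)
      (const 1ᴿ ∷ λ j i → p i j) (s≤s (ℕ.≰⇒> n≰e))
      λ (c , kernel , i , ci≄0) → ci≄0 (p-independent c (∑c≃0 c (kernel zero refl)) (∑cp≃0 c kernel) i)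
  where
  open ℝ-Ring using (setoid; *-congˡ; *-congʳ; *-comm; *-identityˡ; zeroˡ)
  open Relation.Binary.Reasoning.Setoid setoid
  ∑c≃0 : ∀ (c : Vector ℝ (suc n)) → ∑ (λ i → 1ᴿ *ᴿ c i) ≃ 0ᴿ → ∑ c ≃ 0ᴿ
  ∑c≃0 c ∑1c≃0 = begin
    ∑ c                    ≈⟨ ℝ-Sum.sum-cong-≋ {x = λ i → 1ᴿ *ᴿ c i} {c} (λ i → *-identityˡ (c i)) ⟨
    ∑ (λ i → 1ᴿ *ᴿ c i)    ≈⟨ ∑1c≃0 ⟩
    0ᴿ                     ∎
  ∑cp≃0 : ∀ (c : Vector ℝ (suc n)) →
    (∀ j → (true ∷ thick) j ≡ true → ∑ (λ i → (const 1ᴿ ∷ λ j i → p i j) j i *ᴿ c i) ≃ 0ᴿ) →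
    ∀ j → ∑ (λ i → c i *ᴿ p i j) ≃ 0ᴿ
  ∑cp≃0 c kernel j with thick j in eq
  ... | true = begin
    ∑ (λ i → c i *ᴿ p i j)    ≈⟨ ℝ-Sum.sum-cong-≋ {x = λ i → c i *ᴿ p i j} {λ i → p i j *ᴿ c i} (λ i → *-comm (c i) (p i j)) ⟩
    ∑ (λ i → p i j *ᴿ c i)    ≈⟨ kernel (suc j) eq ⟩
    0ᴿ                        ∎
  ... | false = begin
    ∑ (λ i → c i *ᴿ p i j)    ≈⟨ ℝ-Sum.sum-cong-≋ {x = λ i → c i *ᴿ p i j} {λ i → c i *ᴿ lo j} (λ i → *-congˡ {c i} {p i j} {lo j} (p≃lo i)) ⟩
    ∑ (λ i → c i *ᴿ lo j)     ≈⟨ ℝ-Sum.*-distribʳ-sum (lo j) c ⟨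
    ∑ c *ᴿ lo j               ≈⟨ *-congʳ {lo j} {∑ c} {0ᴿ} (∑c≃0 c (kernel zero refl)) ⟩
    0ᴿ *ᴿ lo j                ≈⟨ zeroˡ (lo j) ⟩
    0ᴿ                        ∎
    where
    p≃lo : ∀ i → p i j ≃ lo j
    p≃lo i = ≤ᴿ-antisym {p i j} {lo j}
      (≤ᴿ-trans {p i j} {hi j} {lo j} (proj₂ (p-between i j)) (hi≤lo sh j eq)) (proj₁ (p-between i j))

dimension : ∀ {d} {lo hi : Point d} {thick} {S : Pred (Point d) 0ℓ} → Shape lo hi thick →
  (∀ {x} → x ∈ S → x ∈ Between lo hi) → (∀ {x} → x ∈ Between lo hi → x ∈ S) → HasDimension S (count thick)
dimension sh S⊆ ⊆S = record
  { attained   = let p , p-between , p-independent = affinelyIndependentPoints sh in p , ⊆S ∘ p-between , p-independent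
  ; upperBound = λ { n (p , p∈S , p-independent) → affinelyIndependent⇒≤ sh p (S⊆ ∘ p∈S) p-independent }
  }

dimension-unique : ∀ {d r s} {S : Pred (Point d) 0ℓ} → HasDimension S r → HasDimension S s → r ≡ s
dimension-unique {r = r} {s} dim-r dim-s =
  ℕ.≤-antisym (IsMaximum.upperBound dim-s r (IsMaximum.attained dim-r))
              (IsMaximum.upperBound dim-r s (IsMaximum.attained dim-s))

box-dimension : ∀ {d} (A : StandardBox d) (thick : Fin d → Bool) →
  (∀ j → thick j ≡ true → ¬ upper A j ≤ᴿ lower A j) → (∀ j → thick j ≡ false → upper A j ≤ᴿ lower A j) →
  HasDimension (region A) (count thick)
box-dimension A thick is-thick is-thin =
  dimension {lo = lower A} {upper A} {thick} {region A} (record { lo≤hi = lower≤upper A ; hi≰lo = is-thick ; hi≤lo = is-thin }) (λ x∈A → x∈A) (λ x∈A → x∈A)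

-- Intersections of two boxes

module _ {x y : ℝ} where

  -- Selected by a given comparison, so that each property of x and y passes to the result.
  max : x ≤ᴿ y ⊎ y ≤ᴿ x → ℝ
  max (inj₁ _) = y
  max (inj₂ _) = x

  min : x ≤ᴿ y ⊎ y ≤ᴿ x → ℝ
  min (inj₁ _) = x
  min (inj₂ _) = y

  x≤max : ∀ t → x ≤ᴿ max t
  x≤max (inj₁ x≤y) = x≤y
  x≤max (inj₂ _)   = ≤ᴿ-refl {x}

  y≤max : ∀ t → y ≤ᴿ max t
  y≤max (inj₁ _)   = ≤ᴿ-refl {y}
  y≤max (inj₂ y≤x) = y≤x

  min≤x : ∀ t → min t ≤ᴿ x
  min≤x (inj₁ _)   = ≤ᴿ-refl {x}
  min≤x (inj₂ y≤x) = y≤x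

  min≤y : ∀ t → min t ≤ᴿ y
  min≤y (inj₁ x≤y) = x≤y
  min≤y (inj₂ _)   = ≤ᴿ-refl {y}

  max-elim : ∀ (P : ℝ → Set) t → P x → P y → P (max t)
  max-elim P (inj₁ _) px py = py
  max-elim P (inj₂ _) px py = px

  min-elim : ∀ (P : ℝ → Set) t → P x → P y → P (min t)
  min-elim P (inj₁ _) px py = px
  min-elim P (inj₂ _) px py = py

-- The intersection is the box from the larger lower ends to the smaller upper ends. As both boxes
-- have positive length in every coordinate, it is thin just where one ends no later than the other
-- begins.
intersection-dimension : ∀ {d} (A B : StandardBox d) (thick : Fin d → Bool) →
  (∀ j → lower A j ≤ᴿ lower B j ⊎ lower B j ≤ᴿ lower A j) →
  (∀ j → upper A j ≤ᴿ upper B j ⊎ upper B j ≤ᴿ upper A j) →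
  (∀ j → ¬ upper A j ≤ᴿ lower A j) → (∀ j → ¬ upper B j ≤ᴿ lower B j) →
  (∀ j → lower A j ≤ᴿ upper B j) → (∀ j → lower B j ≤ᴿ upper A j) →
  (∀ j → thick j ≡ true → ¬ upper A j ≤ᴿ lower B j × ¬ upper B j ≤ᴿ lower A j) →
  (∀ j → thick j ≡ false → upper A j ≤ᴿ lower B j ⊎ upper B j ≤ᴿ lower A j) →
  HasDimension (region A ∩ region B) (count thick)
intersection-dimension {d} A B thick tL tU A-full B-full A≤B B≤A is-thick is-thin = dimension shape
  (λ {x} (x∈A , x∈B) j →
      max-elim (_≤ᴿ x j) (tL j) (proj₁ (x∈A j)) (proj₁ (x∈B j)) ,
      min-elim (x j ≤ᴿ_) (tU j) (proj₂ (x∈A j)) (proj₂ (x∈B j)))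
  (λ {x} between →
    (λ j → ≤ᴿ-trans {lower A j} {lo j} {x j} (x≤max {lower A j} {lower B j} (tL j)) (proj₁ (between j)) ,
           ≤ᴿ-trans {x j} {hi j} {upper A j} (proj₂ (between j)) (min≤x {upper A j} {upper B j} (tU j))) ,
    (λ j → ≤ᴿ-trans {lower B j} {lo j} {x j} (y≤max {lower A j} {lower B j} (tL j)) (proj₁ (between j)) ,
           ≤ᴿ-trans {x j} {hi j} {upper B j} (proj₂ (between j)) (min≤y {upper A j} {upper B j} (tU j))))
  where
  lo hi : Point d
  lo j = max {lower A j} {lower B j} (tL j)
  hi j = min {upper A j} {upper B j} (tU j)
  shape : Shape lo hi thick
  shape = record
    { lo≤hi = λ j → max-elim (_≤ᴿ hi j) (tL j)
        (min-elim (lower A j ≤ᴿ_) (tU j) (lower≤upper A j) (A≤B j))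
        (min-elim (lower B j ≤ᴿ_) (tU j) (B≤A j) (lower≤upper B j))
    ; hi≰lo = λ j is-true → max-elim (λ l → ¬ hi j ≤ᴿ l) (tL j)
        (min-elim (λ h → ¬ h ≤ᴿ lower A j) (tU j) (A-full j) (proj₂ (is-thick j is-true)))
        (min-elim (λ h → ¬ h ≤ᴿ lower B j) (tU j) (proj₁ (is-thick j is-true)) (B-full j))
    ; hi≤lo = λ j is-false → [ (λ uA≤lB → through j (upper A j) (lower B j)
                                   (min≤x {upper A j} {upper B j} (tU j)) uA≤lB (y≤max {lower A j} {lower B j} (tL j)))
                             , (λ uB≤lA → through j (upper B j) (lower A j)
                                   (min≤y {upper A j} {upper B j} (tU j)) uB≤lA (x≤max {lower A j} {lower B j} (tL j)))
                             ]′ (is-thin j is-false)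
    }
    where
    through : ∀ j u l → hi j ≤ᴿ u → u ≤ᴿ l → l ≤ᴿ lo j → hi j ≤ᴿ lo j
    through j u l h≤u u≤l l≤lo = ≤ᴿ-trans {hi j} {u} {lo j} h≤u (≤ᴿ-trans {u} {l} {lo j} u≤l l≤lo)

-- Neighborly families of words over {𝟎, 𝟏, ✶}

open import Data.Nat using (_+_; _*_; _∸_; _^_; _≡ᵇ_; _≤_; _<_; _≟_; _≤?_; _<?_)
open import Data.Nat.Properties
open Algebra.Properties.Semiring.Sum +-*-semiring
  using (sum-cong-≗; sum-remove; ∑-distrib-+; ∑-comm; *-distribˡ-sum; *-distribʳ-sum)

data Letter : Set where
  𝟎 𝟏 ✶ : Letter

Word : ℕ → Set
Word = Vector Letter

differ : Letter → Letter → ℕ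
differ 𝟎 𝟏 = 1
differ 𝟏 𝟎 = 1
differ 𝟎 𝟎 = 0
differ 𝟎 ✶ = 0
differ 𝟏 𝟏 = 0
differ 𝟏 ✶ = 0
differ ✶ _ = 0

fixed : Letter → ℕ
fixed 𝟎 = 1
fixed 𝟏 = 1
fixed ✶ = 0

negate : Letter → Letter
negate 𝟎 = 𝟏
negate 𝟏 = 𝟎
negate ✶ = ✶

dist : ∀ {d} → Word d → Word d → ℕ
dist u v = sum λ j → differ (u j) (v j)

support : ∀ {d} → Word d → ℕ
support u = sum (fixed ∘ u)

Neighborly : ∀ {n d} → (Fin n → Word d) → Set
Neighborly K = ∀ {a b} → a ≢ b → 1 ≤ dist (K a) (K b) × dist (K a) (K b) ≤ 2

Bound : ℕ → ℕ → Set
Bound d N = ∀ {n} (K : Fin n → Word d) → Neighborly K → n ≤ N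

totalSupport : ∀ {n d} → (Fin n → Word d) → ℕ
totalSupport K = sum (support ∘ K)

differ-sym : ∀ x y → differ x y ≡ differ y x
differ-sym 𝟎 𝟎 = refl
differ-sym 𝟎 𝟏 = refl
differ-sym 𝟎 ✶ = refl
differ-sym 𝟏 𝟎 = refl
differ-sym 𝟏 𝟏 = refl
differ-sym 𝟏 ✶ = refl
differ-sym ✶ 𝟎 = refl
differ-sym ✶ 𝟏 = refl
differ-sym ✶ ✶ = refl

differ-refl : ∀ x → differ x x ≡ 0
differ-refl 𝟎 = refl
differ-refl 𝟏 = refl
differ-refl ✶ = refl

differ-negate : ∀ x y → differ (negate x) (negate y) ≡ differ x y
differ-negate 𝟎 𝟎 = refl
differ-negate 𝟎 𝟏 = refl
differ-negate 𝟎 ✶ = refl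
differ-negate 𝟏 𝟎 = refl
differ-negate 𝟏 𝟏 = refl
differ-negate 𝟏 ✶ = refl
differ-negate ✶ 𝟎 = refl
differ-negate ✶ 𝟏 = refl
differ-negate ✶ ✶ = refl

fixed-negate : ∀ x → fixed (negate x) ≡ fixed x
fixed-negate 𝟎 = refl
fixed-negate 𝟏 = refl
fixed-negate ✶ = refl

dist-sym : ∀ {d} (u v : Word d) → dist u v ≡ dist v u
dist-sym u v = sum-cong-≗ λ j → differ-sym (u j) (v j)

dist-refl : ∀ {d} (u : Word d) → dist u u ≡ 0
dist-refl u = sum-zero λ j → differ-refl (u j)

dist-negate : ∀ {d} (u v : Word d) → dist (negate ∘ u) (negate ∘ v) ≡ dist u v
dist-negate u v = sum-cong-≗ λ j → differ-negate (u j) (v j)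

support-negate : ∀ {d} (u : Word d) → support (negate ∘ u) ≡ support u
support-negate u = sum-cong-≗ λ j → fixed-negate (u j)

fixed≤1 : ∀ x → fixed x ≤ 1
fixed≤1 𝟎 = ≤-refl
fixed≤1 𝟏 = ≤-refl
fixed≤1 ✶ = z≤n

support≤d : ∀ {d} (u : Word d) → support u ≤ d
support≤d {d} u =
  ≤-trans (sum-mono λ j → fixed≤1 (u j)) (≤-reflexive (trans (sum-const d 1) (*-identityʳ d)))

-- Words as subcubes, and the antipodal inequality

∑cube : ∀ d → (Vector Bool d → ℕ) → ℕ
∑cube zero    f = f []
∑cube (suc d) f = ∑cube d (λ x → f (false ∷ x)) + ∑cube d (λ x → f (true ∷ x))

∑cube-mono : ∀ d {f g : Vector Bool d → ℕ} → (∀ x → f x ≤ g x) → ∑cube d f ≤ ∑cube d g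
∑cube-mono zero    f≤g = f≤g []
∑cube-mono (suc d) f≤g = +-mono-≤ (∑cube-mono d λ x → f≤g (false ∷ x)) (∑cube-mono d λ x → f≤g (true ∷ x))

+-interchange : ∀ a b c d → (a + b) + (c + d) ≡ (a + c) + (b + d)
+-interchange = solve 4 (λ a b c d → (a :+ b) :+ (c :+ d) := (a :+ c) :+ (b :+ d)) refl
  where open +-*-Solver

∑cube-+ : ∀ d (f g : Vector Bool d → ℕ) → ∑cube d (λ x → f x + g x) ≡ ∑cube d f + ∑cube d g
∑cube-+ zero    f g = refl
∑cube-+ (suc d) f g = trans
  (cong₂ _+_ (∑cube-+ d (λ x → f (false ∷ x)) (λ x → g (false ∷ x)))
             (∑cube-+ d (λ x → f (true ∷ x)) (λ x → g (true ∷ x))))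
  (+-interchange (∑cube d λ x → f (false ∷ x)) (∑cube d λ x → g (false ∷ x)) _ _)

∑cube-*ˡ : ∀ d c (f : Vector Bool d → ℕ) → ∑cube d (λ x → c * f x) ≡ c * ∑cube d f
∑cube-*ˡ zero    c f = refl
∑cube-*ˡ (suc d) c f = trans
  (cong₂ _+_ (∑cube-*ˡ d c λ x → f (false ∷ x)) (∑cube-*ˡ d c λ x → f (true ∷ x)))
  (sym (*-distribˡ-+ c (∑cube d λ x → f (false ∷ x)) _))

∑cube-const : ∀ d c → ∑cube d (const c) ≡ 2 ^ d * c
∑cube-const zero    c = sym (*-identityˡ c)
∑cube-const (suc d) c = trans
  (cong₂ _+_ (∑cube-const d c) (∑cube-const d c))
  (solve 2 (λ p c → p :* c :+ p :* c := con 2 :* p :* c) refl (2 ^ d) c)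
  where open +-*-Solver

∑cube-sum : ∀ d {n} (f : Fin n → Vector Bool d → ℕ) →
  ∑cube d (λ x → sum (λ a → f a x)) ≡ sum (λ a → ∑cube d (f a))
∑cube-sum d {zero}  f = trans (∑cube-const d 0) (*-zeroʳ (2 ^ d))
∑cube-sum d {suc n} f = trans (∑cube-+ d (f zero) (λ x → sum (λ a → f (suc a) x)))
                              (cong (∑cube d (f zero) +_) (∑cube-sum d (f ∘ suc)))

match : Letter → Bool → ℕ
match 𝟎 false = 1
match 𝟎 true  = 0
match 𝟏 false = 0
match 𝟏 true  = 1
match ✶ _     = 1

-- The 0-1 indicator of a subcube: 𝟎 and 𝟏 prescribe a coordinate, ✶ leaves it free.
inside : ∀ {d} → Word d → Vector Bool d → ℕ
inside {zero}  u x = 1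
inside {suc d} u x = match (u zero) (x zero) * inside (tail u) (tail x)

size : Letter → ℕ
size 𝟎 = 1
size 𝟏 = 1
size ✶ = 2

volume : ∀ {d} → Word d → ℕ
volume {zero}  u = 1
volume {suc d} u = size (u zero) * volume (tail u)

size-negate : ∀ x → size (negate x) ≡ size x
size-negate 𝟎 = refl
size-negate 𝟏 = refl
size-negate ✶ = refl

volume-negate : ∀ {d} (u : Word d) → volume (negate ∘ u) ≡ volume u
volume-negate {zero}  u = refl
volume-negate {suc d} u = cong₂ _*_ (size-negate (u zero)) (volume-negate (tail u))

volume≡2^[d∸support] : ∀ {d} (u : Word d) → volume u ≡ 2 ^ (d ∸ support u)
volume≡2^[d∸support] {zero}  u = refl
volume≡2^[d∸support] {suc d} u with u zero
... | 𝟎 = trans (+-identityʳ (volume (tail u))) (volume≡2^[d∸support] (tail u))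
... | 𝟏 = trans (+-identityʳ (volume (tail u))) (volume≡2^[d∸support] (tail u))
... | ✶ = trans (cong (2 *_) (volume≡2^[d∸support] (tail u)))
                (cong (2 ^_) (sym (+-∸-assoc 1 (support≤d (tail u)))))

match-sum : ∀ x → match x false + match x true ≡ size x
match-sum 𝟎 = refl
match-sum 𝟏 = refl
match-sum ✶ = refl

∑cube-inside : ∀ {d} (u : Word d) → ∑cube d (inside u) ≡ volume u
∑cube-inside {zero}  u = refl
∑cube-inside {suc d} u = begin
  ∑cube d (λ x → match (u zero) false * inside (tail u) x) + ∑cube d (λ x → match (u zero) true * inside (tail u) x)
    ≡⟨ cong₂ _+_ (∑cube-*ˡ d (match (u zero) false) (inside (tail u))) (∑cube-*ˡ d (match (u zero) true) (inside (tail u))) ⟩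
  match (u zero) false * ∑cube d (inside (tail u)) + match (u zero) true * ∑cube d (inside (tail u))
    ≡⟨ *-distribʳ-+ (∑cube d (inside (tail u))) (match (u zero) false) (match (u zero) true) ⟨
  (match (u zero) false + match (u zero) true) * ∑cube d (inside (tail u))
    ≡⟨ cong₂ _*_ (match-sum (u zero)) (∑cube-inside (tail u)) ⟩
  size (u zero) * volume (tail u) ∎
  where open ≡-Reasoning

match-0∨1 : ∀ x b → match x b ≡ 0 ⊎ match x b ≡ 1
match-0∨1 𝟎 false = inj₂ refl
match-0∨1 𝟎 true  = inj₁ refl
match-0∨1 𝟏 false = inj₁ refl
match-0∨1 𝟏 true  = inj₂ refl
match-0∨1 ✶ b     = inj₂ refl

inside-0∨1 : ∀ {d} (u : Word d) x → inside u x ≡ 0 ⊎ inside u x ≡ 1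
inside-0∨1 {zero}  u x = inj₂ refl
inside-0∨1 {suc d} u x with match-0∨1 (u zero) (x zero)
... | inj₁ ≡0 = inj₁ (cong (_* inside (tail u) (tail x)) ≡0)
... | inj₂ ≡1 with inside-0∨1 (tail u) (tail x)
...   | inj₁ ≡0 = inj₁ (trans (cong₂ _*_ ≡1 ≡0) refl)
...   | inj₂ ≡1′ = inj₂ (cong₂ _*_ ≡1 ≡1′)

match-differ : ∀ x y b → match x b ≡ 1 → match y b ≡ 1 → differ x y ≡ 0
match-differ 𝟎 𝟎 b     _ _ = refl
match-differ 𝟎 ✶ b     _ _ = refl
match-differ 𝟏 𝟏 b     _ _ = refl
match-differ 𝟏 ✶ b     _ _ = refl
match-differ ✶ y b     _ _ = refl
match-differ 𝟎 𝟏 false _ ()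
match-differ 𝟏 𝟎 true  _ ()

common-vertex⇒dist≡0 : ∀ {d} (u v : Word d) x → inside u x ≡ 1 → inside v x ≡ 1 → dist u v ≡ 0
common-vertex⇒dist≡0 {zero}  u v x _ _ = refl
common-vertex⇒dist≡0 {suc d} u v x x∈u x∈v = cong₂ _+_
  (match-differ (u zero) (v zero) (x zero) (m*n≡1⇒m≡1 _ _ x∈u) (m*n≡1⇒m≡1 _ _ x∈v))
  (common-vertex⇒dist≡0 (tail u) (tail v) (tail x)
    (m*n≡1⇒n≡1 (match (u zero) (x zero)) _ x∈u) (m*n≡1⇒n≡1 (match (v zero) (x zero)) _ x∈v))

match-antipodal : ∀ x y b → match x b ≡ 1 → match (negate y) b ≡ 1 → fixed x + fixed y ≤ 1 + differ x y
match-antipodal 𝟎 𝟏 b     _ _ = ≤-refl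
match-antipodal 𝟎 ✶ b     _ _ = ≤-refl
match-antipodal 𝟏 𝟎 b     _ _ = ≤-refl
match-antipodal 𝟏 ✶ b     _ _ = ≤-refl
match-antipodal ✶ y b     _ _ = ≤-trans (fixed≤1 y) (m≤m+n 1 _)
match-antipodal 𝟎 𝟎 false _ ()
match-antipodal 𝟏 𝟏 true  _ ()

-- x lies in u and its antipode in v, so u and v disagree wherever both are fixed.
antipodal-supports : ∀ {d} (u v : Word d) x → inside u x ≡ 1 → inside (negate ∘ v) x ≡ 1 →
  support u + support v ≤ d + dist u v
antipodal-supports {zero}  u v x _ _ = z≤n
antipodal-supports {suc d} u v x x∈u x∈-v = begin
  (fixed (u zero) + support (tail u)) + (fixed (v zero) + support (tail v))
    ≡⟨ +-interchange (fixed (u zero)) (support (tail u)) (fixed (v zero)) (support (tail v)) ⟩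
  (fixed (u zero) + fixed (v zero)) + (support (tail u) + support (tail v))
    ≤⟨ +-mono-≤ (match-antipodal (u zero) (v zero) (x zero) (m*n≡1⇒m≡1 _ _ x∈u) (m*n≡1⇒m≡1 _ _ x∈-v))
                (antipodal-supports (tail u) (tail v) (tail x)
                  (m*n≡1⇒n≡1 (match (u zero) (x zero)) _ x∈u)
                  (m*n≡1⇒n≡1 (match (negate (v zero)) (x zero)) _ x∈-v)) ⟩
  (1 + differ (u zero) (v zero)) + (d + dist (tail u) (tail v))
    ≡⟨ +-interchange 1 (differ (u zero) (v zero)) d (dist (tail u) (tail v)) ⟩
  suc d + dist u v ∎
  where open ≤-Reasoning

weightAt : ∀ {n d} → (Fin n → Word d) → Vector Bool d → ℕ
weightAt K x = sum λ a → suc (support (K a)) * inside (K a) x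

-- Words with a common vertex are at distance 0, so neighborly words are disjoint subcubes and at
-- most one term survives.
weightAt-value : ∀ {n d} (K : Fin n → Word d) → Neighborly K → ∀ x →
  weightAt K x ≡ 0 ⊎ (∃ λ a → inside (K a) x ≡ 1 × weightAt K x ≡ suc (support (K a)))
weightAt-value K nb x = case sum-atMostOneNonzero _ single of λ where
    (inj₁ ≡0)             → inj₁ ≡0
    (inj₂ (a , ≢0 , ≡fa)) → inj₂ (a , nonzero⇒inside a ≢0 ,
      trans ≡fa (trans (cong (suc (support (K a)) *_) (nonzero⇒inside a ≢0)) (*-identityʳ _)))
  where
  nonzero⇒inside : ∀ a → suc (support (K a)) * inside (K a) x ≢ 0 → inside (K a) x ≡ 1
  nonzero⇒inside a ≢0 with inside-0∨1 (K a) x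
  ... | inj₁ ≡0 = contradiction (trans (cong (suc (support (K a)) *_) ≡0) (*-zeroʳ (suc (support (K a))))) ≢0
  ... | inj₂ ≡1 = ≡1

  single : AtMostOneNonzero (λ a → suc (support (K a)) * inside (K a) x)
  single {a} {b} a≢b ≢0 with inside-0∨1 (K b) x
  ... | inj₁ ≡0 = trans (cong (suc (support (K b)) *_) ≡0) (*-zeroʳ (suc (support (K b))))
  ... | inj₂ ≡1 = contradiction
    (subst (1 ≤_) (common-vertex⇒dist≡0 (K a) (K b) x (nonzero⇒inside a ≢0) ≡1) (proj₁ (nb a≢b))) λ ()

neighborly-negate : ∀ {n d} (K : Fin n → Word d) → Neighborly K → Neighborly (λ a → negate ∘ K a)
neighborly-negate K nb {a} {b} a≢b rewrite dist-negate (K a) (K b) = nb a≢b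

dist≤2 : ∀ {n d} (K : Fin n → Word d) → Neighborly K → ∀ a b → dist (K a) (K b) ≤ 2
dist≤2 K nb a b with a ≟F b
... | yes refl = ≤-trans (≤-reflexive (dist-refl (K a))) z≤n
... | no  a≢b  = proj₂ (nb a≢b)

-- A negated word contains x when the word itself contains the antipode of x. If both vertices are
-- covered, the supports add up to at most d + 2, and the weights exceed them by 1 each; otherwise
-- at most one weight, of at most d + 1, is present.
weightAt-antipodal : ∀ {n d} (K : Fin n → Word d) → Neighborly K → ∀ x →
  weightAt K x + weightAt (λ a → negate ∘ K a) x ≤ d + 4
weightAt-antipodal {n} {d} K nb x
  with weightAt-value K nb x | weightAt-value _ (neighborly-negate K nb) x
... | inj₁ ≡0 | inj₁ ≡0′ rewrite ≡0 | ≡0′ = z≤n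
... | inj₁ ≡0 | inj₂ (b , _ , ≡b) rewrite ≡0 | ≡b | support-negate (K b) = begin
  suc (support (K b)) ≤⟨ s≤s (support≤d (K b)) ⟩
  1 + d               ≤⟨ +-monoˡ-≤ d (s≤s z≤n) ⟩
  4 + d               ≡⟨ +-comm 4 d ⟩
  d + 4               ∎
  where open ≤-Reasoning
... | inj₂ (a , _ , ≡a) | inj₁ ≡0 rewrite ≡0 | ≡a = begin
  suc (support (K a)) + 0 ≡⟨ +-identityʳ _ ⟩
  suc (support (K a))     ≤⟨ s≤s (support≤d (K a)) ⟩
  1 + d                   ≤⟨ +-monoˡ-≤ d (s≤s z≤n) ⟩
  4 + d                   ≡⟨ +-comm 4 d ⟩
  d + 4                   ∎
  where open ≤-Reasoning
... | inj₂ (a , x∈a , ≡a) | inj₂ (b , x∈-b , ≡b) rewrite ≡a | ≡b | support-negate (K b) = begin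
  suc (support (K a)) + suc (support (K b))
    ≡⟨ +-interchange 1 (support (K a)) 1 (support (K b)) ⟩
  2 + (support (K a) + support (K b))
    ≤⟨ +-monoʳ-≤ 2 (antipodal-supports (K a) (K b) x x∈a x∈-b) ⟩
  2 + (d + dist (K a) (K b))
    ≤⟨ +-monoʳ-≤ 2 (+-monoʳ-≤ d (dist≤2 K nb a b)) ⟩
  2 + (d + 2)
    ≡⟨ solve 1 (λ d → con 2 :+ (d :+ con 2) := d :+ con 4) refl d ⟩
  d + 4 ∎
  where
  open ≤-Reasoning
  open +-*-Solver

totalWeight : ∀ {n d} → (Fin n → Word d) → ℕ
totalWeight K = sum λ a → suc (support (K a)) * volume (K a)

∑cube-weightAt : ∀ {n d} (K : Fin n → Word d) → ∑cube d (weightAt K) ≡ totalWeight K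
∑cube-weightAt {d = d} K = trans (∑cube-sum d λ a x → suc (support (K a)) * inside (K a) x)
  (sum-cong-≗ λ a → trans (∑cube-*ˡ d (suc (support (K a))) (inside (K a)))
                          (cong (suc (support (K a)) *_) (∑cube-inside (K a))))

-- The antipodal inequality is summed over the cube. Negation preserves support and volume, so both
-- halves have the same total.
2*totalWeight≤ : ∀ {n d} (K : Fin n → Word d) → Neighborly K → 2 * totalWeight K ≤ 2 ^ d * (d + 4)
2*totalWeight≤ {d = d} K nb = begin
  2 * totalWeight K
    ≡⟨ cong (totalWeight K +_) (+-identityʳ (totalWeight K)) ⟩
  totalWeight K + totalWeight K
    ≡⟨ cong (totalWeight K +_) (sum-cong-≗ λ a →
         cong₂ (λ s v → suc s * v) (support-negate (K a)) (volume-negate (K a))) ⟨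
  totalWeight K + totalWeight (λ a → negate ∘ K a)
    ≡⟨ cong₂ _+_ (∑cube-weightAt K) (∑cube-weightAt (λ a → negate ∘ K a)) ⟨
  ∑cube d (weightAt K) + ∑cube d (weightAt (λ a → negate ∘ K a))
    ≡⟨ ∑cube-+ d (weightAt K) _ ⟨
  ∑cube d (λ x → weightAt K x + weightAt (λ a → negate ∘ K a) x)
    ≤⟨ ∑cube-mono d (weightAt-antipodal K nb) ⟩
  ∑cube d (const (d + 4))
    ≡⟨ ∑cube-const d (d + 4) ⟩
  2 ^ d * (d + 4) ∎
  where open ≤-Reasoning

-- Saturated families

AdjacentAlong : ∀ {n d} → (Fin n → Word d) → Fin n → Fin d → Fin n → Set
AdjacentAlong K a j b = dist (K a) (K b) ≡ 1 × differ (K a j) (K b j) ≡ 1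

adjacentAlong? : ∀ {n d} (K : Fin n → Word d) a j b → Dec (AdjacentAlong K a j b)
adjacentAlong? K a j b = (dist (K a) (K b) ≟ 1) ×-dec (differ (K a j) (K b j) ≟ 1)

-- Freeing any fixed letter of a saturated family would merge two words.
Saturated : ∀ {n d} → (Fin n → Word d) → Set
Saturated K = ∀ a j → fixed (K a j) ≡ 1 → ∃ (AdjacentAlong K a j)

freeLetter : ∀ {d} → Word d → Fin d → Word d
freeLetter u j = updateAt u j (const ✶)

dist-freeLetter : ∀ {d} (u v : Word d) j → dist (freeLetter u j) v + differ (u j) (v j) ≡ dist u v
dist-freeLetter u v zero    = +-comm (dist (tail u) (tail v)) (differ (u zero) (v zero))
dist-freeLetter u v (suc j) = trans (+-assoc (differ (u zero) (v zero)) _ _)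
  (cong (differ (u zero) (v zero) +_) (dist-freeLetter (tail u) (tail v) j))

support-freeLetter : ∀ {d} (u : Word d) j → support (freeLetter u j) + fixed (u j) ≡ support u
support-freeLetter u zero    = +-comm (support (tail u)) (fixed (u zero))
support-freeLetter u (suc j) = trans (+-assoc (fixed (u zero)) _ _)
  (cong (fixed (u zero) +_) (support-freeLetter (tail u) j))

module _ {n d} (K : Fin n → Word d) (a : Fin n) (j : Fin d) where

  freeLetterOf : Fin n → Word d
  freeLetterOf = updateAt K a (λ u → freeLetter u j)

  freeLetterOf-self : freeLetterOf a ≡ freeLetter (K a) j
  freeLetterOf-self = updateAt-updates a K

  freeLetterOf-other : ∀ {b} → b ≢ a → freeLetterOf b ≡ K b
  freeLetterOf-other {b} b≢a = updateAt-minimal b a K b≢a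

  -- Freeing position j lowers a distance by at most 1, and only to words that differ there.
  -- Distance 0 would arise only from a word adjacent along j.
  freeLetterOf-neighborly : Neighborly K → ¬ ∃ (AdjacentAlong K a j) → Neighborly freeLetterOf
  freeLetterOf-neighborly nb none = pair
    where
    self : ∀ {c} → c ≢ a → 1 ≤ dist (freeLetter (K a) j) (K c) × dist (freeLetter (K a) j) (K c) ≤ 2
    self {c} c≢a with nb (c≢a ∘ sym) | dist-freeLetter (K a) (K c) j
    ... | 1≤ , ≤2 | eq with differ (K a j) (K c j) in dj
    ...   | 0 rewrite sym (trans (sym (+-identityʳ _)) eq) = 1≤ , ≤2
    ...   | 1 with dist (freeLetter (K a) j) (K c)
    ...     | 0       = contradiction (c , sym eq , dj) none
    ...     | (suc m) = s≤s z≤n , ≤-trans (≤-trans (m≤m+n (suc m) 1) (≤-reflexive eq)) ≤2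
    self {c} c≢a | 1≤ , ≤2 | eq | suc (suc e) = contradiction dj (differ≢2+ (K a j) (K c j))
      where
      differ≢2+ : ∀ x y → differ x y ≢ suc (suc e)
      differ≢2+ 𝟎 𝟎 ()
      differ≢2+ 𝟎 𝟏 ()
      differ≢2+ 𝟎 ✶ ()
      differ≢2+ 𝟏 𝟎 ()
      differ≢2+ 𝟏 𝟏 ()
      differ≢2+ 𝟏 ✶ ()
      differ≢2+ ✶ _ ()
    pair : Neighborly freeLetterOf
    pair {b} {c} b≢c with b ≟F a | c ≟F a
    ... | yes refl | yes refl = contradiction refl b≢c
    ... | yes refl | no  c≢a rewrite freeLetterOf-self | freeLetterOf-other c≢a = self c≢a
    ... | no  b≢a  | yes refl
      rewrite freeLetterOf-self | freeLetterOf-other b≢a | dist-sym (K b) (freeLetter (K a) j) = self b≢a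
    ... | no  b≢a  | no  c≢a rewrite freeLetterOf-other b≢a | freeLetterOf-other c≢a = nb b≢c

  freeLetterOf-totalSupport : fixed (K a j) ≡ 1 → totalSupport freeLetterOf < totalSupport K
  freeLetterOf-totalSupport fixed≡1 = sum-mono-< le (a , lt)
    where
    lt : support (freeLetterOf a) < support (K a)
    lt rewrite freeLetterOf-self = ≤-reflexive (begin
      suc (support (freeLetter (K a) j))             ≡⟨ +-comm 1 _ ⟩
      support (freeLetter (K a) j) + 1               ≡⟨ cong (support (freeLetter (K a) j) +_) fixed≡1 ⟨
      support (freeLetter (K a) j) + fixed (K a j)   ≡⟨ support-freeLetter (K a) j ⟩
      support (K a)                                  ∎)
      where open ≡-Reasoning
    le : ∀ b → support (freeLetterOf b) ≤ support (K b)
    le b with b ≟F a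
    ... | yes refl = <⇒≤ lt
    ... | no  b≢a rewrite freeLetterOf-other b≢a = ≤-refl

-- Letters are freed while possible; the total support decreases each time, so this ends.
saturate : ∀ {n d} (K : Fin n → Word d) → Neighborly K → ∃ λ (K′ : Fin n → Word d) → Neighborly K′ × Saturated K′
saturate K nb = go K nb (<-wellFounded (totalSupport K))
  where
  go : ∀ {n d} (K : Fin n → Word d) → Neighborly K → Acc _<_ (totalSupport K) →
       ∃ λ (K′ : Fin n → Word d) → Neighborly K′ × Saturated K′
  go {n} {d} K nb (acc rs) with any? (λ a → any? λ j → (fixed (K a j) ≟ 1) ×-dec ¬? (any? (adjacentAlong? K a j)))
  ... | yes (a , j , fixed≡1 , none) =
        go (freeLetterOf K a j) (freeLetterOf-neighborly K a j nb none)
           (rs (freeLetterOf-totalSupport K a j fixed≡1))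
  ... | no  ¬free = K , nb , λ a j fixed≡1 → decidable-stable (any? (adjacentAlong? K a j)) λ none →
        ¬free (a , j , fixed≡1 , none)

-- Double counting of differing positions

isOne : ℕ → ℕ
isOne 1 = 1
isOne 0 = 0
isOne (suc (suc _)) = 0

+-isOne≤2 : ∀ {m} → m ≤ 2 → m + isOne m ≤ 2
+-isOne≤2 {0} _ = z≤n
+-isOne≤2 {1} _ = ≤-refl
+-isOne≤2 {2} _ = ≤-refl
+-isOne≤2 {suc (suc (suc _))} (s≤s (s≤s ()))

isOne-* : ∀ m → isOne m * m ≡ isOne m
isOne-* 0 = refl
isOne-* 1 = refl
isOne-* (suc (suc _)) = refl

-- Saturation gives each fixed position of a word a partner at distance 1 that differs from it
-- there. Such a partner differs in that position alone, so distinct positions have distinct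
-- partners.
neighbors≥support : ∀ {n d} (K : Fin n → Word d) → Saturated K → ∀ a →
  support (K a) ≤ sum λ b → isOne (dist (K a) (K b))
neighbors≥support {n} {d} K sat a = begin
  sum (λ j → fixed (K a j))                    ≤⟨ sum-mono at-least-one ⟩
  sum (λ j → sum λ b → adjacent b j)           ≡⟨ ∑-comm (λ j b → adjacent b j) ⟩
  sum (λ b → sum λ j → adjacent b j)           ≡⟨ sum-cong-≗ (λ b → *-distribˡ-sum (isOne (dist (K a) (K b))) λ j → differ (K a j) (K b j)) ⟨
  sum (λ b → isOne (dist (K a) (K b)) * dist (K a) (K b))
                                               ≡⟨ sum-cong-≗ (λ b → isOne-* (dist (K a) (K b))) ⟩
  sum (λ b → isOne (dist (K a) (K b)))         ∎
  where
  open ≤-Reasoning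
  adjacent : Fin n → Fin d → ℕ
  adjacent b j = isOne (dist (K a) (K b)) * differ (K a j) (K b j)
  at-least-one : ∀ j → fixed (K a j) ≤ sum λ b → adjacent b j
  at-least-one j with fixed (K a j) in eq
  ... | 0 = z≤n
  ... | 1 with sat a j eq
  ...   | b , dist≡1 , differ≡1 = ≤-trans
          (≤-reflexive (sym (cong₂ (λ m e → isOne m * e) dist≡1 differ≡1))) (term≤sum (λ b → adjacent b j) b)
  at-least-one j | suc (suc e) = contradiction (subst (_≤ 1) eq (fixed≤1 (K a j))) λ { (s≤s ()) }

pairs≤ : ∀ {p d} (K : Fin (suc p) → Word d) → Neighborly K →
  sum (λ a → sum λ b → dist (K a) (K b) + isOne (dist (K a) (K b))) ≤ suc p * (p * 2)
pairs≤ {p} K nb = begin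
  sum (λ a → sum (h a))        ≤⟨ sum-mono row ⟩
  sum {suc p} (const (p * 2))  ≡⟨ sum-const (suc p) (p * 2) ⟩
  suc p * (p * 2)              ∎
  where
  open ≤-Reasoning
  h : Fin (suc p) → Fin (suc p) → ℕ
  h a b = dist (K a) (K b) + isOne (dist (K a) (K b))
  row : ∀ a → sum (h a) ≤ p * 2
  row a = begin
    sum (h a)                         ≡⟨ sum-remove {i = a} (h a) ⟩
    h a a + sum (removeAt (h a) a)    ≡⟨ cong (_+ sum (removeAt (h a) a)) (cong (λ m → m + isOne m) (dist-refl (K a))) ⟩
    sum (removeAt (h a) a)            ≤⟨ sum-mono {p} (λ b → +-isOne≤2 (dist≤2 K nb a (punchIn a b))) ⟩
    sum {p} (const 2)                 ≡⟨ sum-const p 2 ⟩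
    p * 2                             ∎

is𝟏 : Letter → Bool
is𝟏 𝟎 = false
is𝟏 𝟏 = true
is𝟏 ✶ = false

#𝟏 : ∀ {n d} → (Fin n → Word d) → Fin d → ℕ
#𝟏 K j = sum λ a → indicator (is𝟏 (K a j))

#𝟎 : ∀ {n d} → (Fin n → Word d) → Fin d → ℕ
#𝟎 K = #𝟏 λ a → negate ∘ K a

differ-indicator : ∀ x y → differ x y ≡
  indicator (is𝟏 (negate x)) * indicator (is𝟏 y) + indicator (is𝟏 x) * indicator (is𝟏 (negate y))
differ-indicator 𝟎 𝟎 = refl
differ-indicator 𝟎 𝟏 = refl
differ-indicator 𝟎 ✶ = refl
differ-indicator 𝟏 𝟎 = refl
differ-indicator 𝟏 𝟏 = refl
differ-indicator 𝟏 ✶ = refl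
differ-indicator ✶ y = refl

fixed-indicator : ∀ x → fixed x ≡ indicator (is𝟏 (negate x)) + indicator (is𝟏 x)
fixed-indicator 𝟎 = refl
fixed-indicator 𝟏 = refl
fixed-indicator ✶ = refl

sum-* : ∀ {n} (f g : Vector ℕ n) → sum (λ a → sum λ b → f a * g b) ≡ sum f * sum g
sum-* f g = trans (sum-cong-≗ λ a → sym (*-distribˡ-sum (f a) g)) (sym (*-distribʳ-sum (sum g) f))

-- Ordered pairs are counted, hence the factor 2.
∑differ : ∀ {n d} (K : Fin n → Word d) j →
  sum (λ a → sum λ b → differ (K a j) (K b j)) ≡ 2 * (#𝟎 K j * #𝟏 K j)
∑differ {n} K j = begin
  sum (λ a → sum λ b → differ (K a j) (K b j))
    ≡⟨ sum-cong-≗ (λ a → trans (sum-cong-≗ λ b → differ-indicator (K a j) (K b j))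
                               (∑-distrib-+ (λ b → z a * o b) (λ b → o a * z b))) ⟩
  sum (λ a → sum (λ b → z a * o b) + sum (λ b → o a * z b))
    ≡⟨ ∑-distrib-+ (λ a → sum λ b → z a * o b) (λ a → sum λ b → o a * z b) ⟩
  sum (λ a → sum λ b → z a * o b) + sum (λ a → sum λ b → o a * z b)
    ≡⟨ cong₂ _+_ (sum-* z o) (trans (sum-* o z) (trans (*-comm (sum o) (sum z)) (sym (+-identityʳ _)))) ⟩
  2 * (#𝟎 K j * #𝟏 K j) ∎
  where
  open ≡-Reasoning
  z o : Fin n → ℕ
  z a = indicator (is𝟏 (negate (K a j)))
  o a = indicator (is𝟏 (K a j))

∑dist : ∀ {n d} (K : Fin n → Word d) →
  sum (λ a → sum λ b → dist (K a) (K b)) ≡ sum λ j → 2 * (#𝟎 K j * #𝟏 K j)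
∑dist K = begin
  sum (λ a → sum λ b → sum λ j → differ (K a j) (K b j)) ≡⟨ sum-cong-≗ (λ a → ∑-comm λ b j → differ (K a j) (K b j)) ⟩
  sum (λ a → sum λ j → sum λ b → differ (K a j) (K b j)) ≡⟨ ∑-comm (λ a j → sum λ b → differ (K a j) (K b j)) ⟩
  sum (λ j → sum λ a → sum λ b → differ (K a j) (K b j)) ≡⟨ sum-cong-≗ (∑differ K) ⟩
  sum (λ j → 2 * (#𝟎 K j * #𝟏 K j))                      ∎
  where open ≡-Reasoning

totalSupport≡ : ∀ {n d} (K : Fin n → Word d) → totalSupport K ≡ sum λ j → #𝟎 K j + #𝟏 K j
totalSupport≡ K = begin
  sum (λ a → sum λ j → fixed (K a j))    ≡⟨ ∑-comm (λ a j → fixed (K a j)) ⟩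
  sum (λ j → sum λ a → fixed (K a j))    ≡⟨ sum-cong-≗ (λ j → trans (sum-cong-≗ λ a → fixed-indicator (K a j))
                                              (∑-distrib-+ (λ a → indicator (is𝟏 (negate (K a j)))) (λ a → indicator (is𝟏 (K a j))))) ⟩
  sum (λ j → #𝟎 K j + #𝟏 K j)            ∎
  where open ≡-Reasoning

-- Each ordered pair of distinct words has distance at most 2, and a pair at distance 1 leaves one
-- unit to spare. By saturation these spare units number at least the total support.
∑2#𝟎#𝟏+totalSupport≤ : ∀ {p d} (K : Fin (suc p) → Word d) → Neighborly K → Saturated K →
  sum (λ j → 2 * (#𝟎 K j * #𝟏 K j)) + totalSupport K ≤ suc p * (p * 2)
∑2#𝟎#𝟏+totalSupport≤ {p} K nb sat = begin
  sum (λ j → 2 * (#𝟎 K j * #𝟏 K j)) + totalSupport K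
    ≤⟨ +-mono-≤ (≤-reflexive (sym (∑dist K))) (sum-mono (neighbors≥support K sat)) ⟩
  sum (λ a → sum λ b → dist (K a) (K b)) + sum (λ a → sum λ b → isOne (dist (K a) (K b)))
    ≡⟨ ∑-distrib-+ (λ a → sum λ b → dist (K a) (K b)) (λ a → sum λ b → isOne (dist (K a) (K b))) ⟨
  sum (λ a → sum (λ b → dist (K a) (K b)) + sum (λ b → isOne (dist (K a) (K b))))
    ≡⟨ sum-cong-≗ (λ a → ∑-distrib-+ (λ b → dist (K a) (K b)) (λ b → isOne (dist (K a) (K b)))) ⟨
  sum (λ a → sum λ b → dist (K a) (K b) + isOne (dist (K a) (K b)))
    ≤⟨ pairs≤ K nb ⟩
  suc p * (p * 2) ∎
  where open ≤-Reasoning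

-- The recursive bound

indicator-not : ∀ b → indicator (not b) + indicator b ≡ 1
indicator-not true  = refl
indicator-not false = refl

differ-no𝟏 : ∀ x y → not (is𝟏 x) ≡ true → not (is𝟏 y) ≡ true → differ x y ≡ 0
differ-no𝟏 𝟎 𝟎 _ _ = refl
differ-no𝟏 𝟎 ✶ _ _ = refl
differ-no𝟏 ✶ y _ _ = refl
differ-no𝟏 𝟎 𝟏 _ ()
differ-no𝟏 𝟏 y () _

-- The words without 𝟏 at j remain neighborly when position j is deleted.
#𝟏-large : ∀ {n d N} → Bound d N → (K : Fin n → Word (suc d)) → Neighborly K → ∀ j → n ≤ N + #𝟏 K j
#𝟏-large {n} {d} {N} bound K nb j with enumerate (λ a → not (is𝟏 (K a j)))
... | e , injective , no𝟏 = begin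
  n                                     ≡⟨ *-identityʳ n ⟨
  n * 1                                 ≡⟨ sum-const n 1 ⟨
  sum {n} (const 1)                     ≡⟨ sum-cong-≗ (λ a → indicator-not (is𝟏 (K a j))) ⟨
  sum (λ a → indicator (not (is𝟏 (K a j))) + indicator (is𝟏 (K a j)))
                                        ≡⟨ ∑-distrib-+ (λ a → indicator (not (is𝟏 (K a j)))) (λ a → indicator (is𝟏 (K a j))) ⟩
  sum (λ a → indicator (not (is𝟏 (K a j)))) + #𝟏 K j
                                        ≤⟨ +-monoˡ-≤ (#𝟏 K j) (bound (λ a → removeAt (K (e a)) j) restricted) ⟩
  N + #𝟏 K j                            ∎
  where
  open ≤-Reasoning
  restricted : Neighborly (λ a → removeAt (K (e a)) j)
  restricted {a} {b} a≢b = subst (λ m → 1 ≤ m × m ≤ 2)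
    (trans (sum-remove {i = j} (λ i → differ (K (e a) i) (K (e b) i)))
           (cong (_+ dist (removeAt (K (e a)) j) (removeAt (K (e b)) j)) (differ-no𝟏 (K (e a) j) (K (e b) j) (no𝟏 a) (no𝟏 b))))
    (nb (a≢b ∘ injective))

-- (#𝟎 − m)(#𝟏 − m) ≥ 0
2m[x+y]≤2xy+2mm : ∀ {m x y} → m ≤ x → m ≤ y → 2 * m * (x + y) ≤ 2 * (x * y) + 2 * (m * m)
2m[x+y]≤2xy+2mm {m} m≤x m≤y with m≤n⇒∃[o]m+o≡n m≤x | m≤n⇒∃[o]m+o≡n m≤y
... | p , refl | q , refl = ≤-trans (m≤m+n _ (2 * (p * q))) (≤-reflexive
  (solve 3 (λ m p q → con 2 :* m :* ((m :+ p) :+ (m :+ q)) :+ con 2 :* (p :* q)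
    := con 2 :* ((m :+ p) :* (m :+ q)) :+ con 2 :* (m :* m)) refl m p q))
  where open +-*-Solver

-- Both letters occur at least m = n - N times in each position, which bounds 2 #𝟎 #𝟏 below by 2m
-- (#𝟎 + #𝟏) - 2m². Summed over the positions, this replaces the products in the double count by 2m
-- times the total support.
totalSupport-upper : ∀ {d N m p} → Bound d N → N + m ≡ suc p →
  (K : Fin (suc p) → Word (suc d)) → Neighborly K → Saturated K →
  (2 * m + 1) * totalSupport K ≤ suc p * (p * 2) + suc d * (2 * (m * m))
totalSupport-upper {d} {N} {m} {p} bound N+m≡n K nb sat = begin
  (2 * m + 1) * totalSupport K
    ≡⟨ solve 2 (λ m s → (con 2 :* m :+ con 1) :* s := con 2 :* m :* s :+ s) refl m (totalSupport K) ⟩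
  2 * m * totalSupport K + totalSupport K
    ≡⟨ cong (λ s → 2 * m * s + totalSupport K) (totalSupport≡ K) ⟩
  2 * m * sum (λ j → #𝟎 K j + #𝟏 K j) + totalSupport K
    ≡⟨ cong (_+ totalSupport K) (*-distribˡ-sum (2 * m) (λ j → #𝟎 K j + #𝟏 K j)) ⟩
  sum (λ j → 2 * m * (#𝟎 K j + #𝟏 K j)) + totalSupport K
    -- The bound on #𝟎 is the bound on #𝟏 for the negated family.
    ≤⟨ +-monoˡ-≤ (totalSupport K) (sum-mono λ j → 2m[x+y]≤2xy+2mm (large (λ a → negate ∘ K a) (neighborly-negate K nb) j) (large K nb j)) ⟩
  sum (λ j → 2 * (#𝟎 K j * #𝟏 K j) + 2 * (m * m)) + totalSupport K
    ≡⟨ cong (_+ totalSupport K) (trans (∑-distrib-+ (λ j → 2 * (#𝟎 K j * #𝟏 K j)) (const (2 * (m * m))))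
         (cong (sum (λ j → 2 * (#𝟎 K j * #𝟏 K j)) +_) (sum-const (suc d) (2 * (m * m))))) ⟩
  sum (λ j → 2 * (#𝟎 K j * #𝟏 K j)) + suc d * (2 * (m * m)) + totalSupport K
    ≡⟨ solve 3 (λ a b c → a :+ b :+ c := a :+ c :+ b) refl
         (sum λ j → 2 * (#𝟎 K j * #𝟏 K j)) (suc d * (2 * (m * m))) (totalSupport K) ⟩
  sum (λ j → 2 * (#𝟎 K j * #𝟏 K j)) + totalSupport K + suc d * (2 * (m * m))
    ≤⟨ +-monoˡ-≤ (suc d * (2 * (m * m))) (∑2#𝟎#𝟏+totalSupport≤ K nb sat) ⟩
  suc p * (p * 2) + suc d * (2 * (m * m)) ∎
  where
  open ≤-Reasoning
  open +-*-Solver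
  large : ∀ (K : Fin (suc p) → Word (suc d)) → Neighborly K → ∀ j → m ≤ #𝟏 K j
  large K nb j = +-cancelˡ-≤ N _ _ (≤-trans (≤-reflexive N+m≡n) (#𝟏-large bound K nb j))

-- The weight (s + 1) 2^(d − s) of a word of support s lies above the line (β − γ s) / α.
LineBelow : ℕ → ℕ → ℕ → ℕ → Set
LineBelow d α β γ = ∀ (i : Fin (suc d)) → let s = Fin.toℕ i in β ≤ α * (suc s * 2 ^ (d ∸ s)) + γ * s

lineBelow? : ∀ d α β γ → Dec (LineBelow d α β γ)
lineBelow? d α β γ = all? λ i → let s = Fin.toℕ i in β ≤? α * (suc s * 2 ^ (d ∸ s)) + γ * s

-- The line is summed over the words, so that the distribution of the supports enters only through
-- their total; the total weight is then bounded by the antipodal inequality.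
totalSupport-lower : ∀ {n d α β γ} → LineBelow d α β γ → (K : Fin n → Word d) → Neighborly K →
  2 * (n * β) ≤ α * (2 ^ d * (d + 4)) + 2 * (γ * totalSupport K)
totalSupport-lower {n} {d} {α} {β} {γ} line K nb = begin
  2 * (n * β)
    ≡⟨ cong (2 *_) (sum-const n β) ⟨
  2 * sum {n} (const β)
    ≤⟨ *-monoʳ-≤ 2 (sum-mono at) ⟩
  2 * sum (λ a → α * (suc (support (K a)) * volume (K a)) + γ * support (K a))
    ≡⟨ cong (2 *_) (trans (∑-distrib-+ (λ a → α * (suc (support (K a)) * volume (K a))) (λ a → γ * support (K a)))
         (sym (cong₂ _+_ (*-distribˡ-sum α (λ a → suc (support (K a)) * volume (K a))) (*-distribˡ-sum γ (support ∘ K))))) ⟩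
  2 * (α * totalWeight K + γ * totalSupport K)
    ≡⟨ solve 4 (λ α w γ s → con 2 :* (α :* w :+ γ :* s) := α :* (con 2 :* w) :+ con 2 :* (γ :* s)) refl α (totalWeight K) γ (totalSupport K) ⟩
  α * (2 * totalWeight K) + 2 * (γ * totalSupport K)
    ≤⟨ +-monoˡ-≤ _ (*-monoʳ-≤ α (2*totalWeight≤ K nb)) ⟩
  α * (2 ^ d * (d + 4)) + 2 * (γ * totalSupport K) ∎
  where
  open ≤-Reasoning
  open +-*-Solver
  at : ∀ a → β ≤ α * (suc (support (K a)) * volume (K a)) + γ * support (K a)
  at a = subst (λ s → β ≤ α * (suc s * volume (K a)) + γ * s) toℕ≡
    (subst (λ v → β ≤ α * (suc (Fin.toℕ i) * v) + γ * Fin.toℕ i)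
      (trans (cong (λ s → 2 ^ (d ∸ s)) toℕ≡) (sym (volume≡2^[d∸support] (K a)))) (line i))
    where
    i : Fin (suc d)
    i = Fin.fromℕ< (s≤s (support≤d (K a)))
    toℕ≡ : Fin.toℕ i ≡ support (K a)
    toℕ≡ = toℕ-fromℕ< (s≤s (support≤d (K a)))

-- The family has n = p + 1 members.
Contradictory : (d m p α β γ : ℕ) → Set
Contradictory d m p α β γ =
  (2 * m + 1) * (α * (2 ^ d * (d + 4))) + 2 * (γ * (suc p * (p * 2) + d * (2 * (m * m))))
    < (2 * m + 1) * (2 * (suc p * β))

-- After saturation both estimates hold for the same total support. Multiplying the lower one by 2m
-- + 1 allows the upper one to be inserted, which eliminates the support.
noFamily : ∀ {d N m p α β γ} → Bound d N → N + m ≡ suc p → LineBelow (suc d) α β γ →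
  Contradictory (suc d) m p α β γ → (K : Fin (suc p) → Word (suc d)) → ¬ Neighborly K
noFamily {d} {N} {m} {p} {α} {β} {γ} bound N+m≡n line contra K₀ nb₀ with saturate K₀ nb₀
... | K , nb , sat = <⇒≱ contra (begin
  c * (2 * (suc p * β))
    ≤⟨ *-monoʳ-≤ c (totalSupport-lower {α = α} {β} {γ} line K nb) ⟩
  c * (w + 2 * (γ * s))
    ≡⟨ solve 4 (λ c w γ s → c :* (w :+ con 2 :* (γ :* s)) := c :* w :+ con 2 :* (γ :* (c :* s))) refl c w γ s ⟩
  c * w + 2 * (γ * (c * s))
    ≤⟨ +-monoʳ-≤ (c * w) (*-monoʳ-≤ 2 (*-monoʳ-≤ γ (totalSupport-upper {N = N} {m} bound N+m≡n K nb sat))) ⟩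
  c * w + 2 * (γ * (suc p * (p * 2) + suc d * (2 * (m * m)))) ∎)
  where
  open ≤-Reasoning
  open +-*-Solver
  c w s : ℕ
  c = 2 * m + 1
  w = α * (2 ^ suc d * (suc d + 4))
  s = totalSupport K

contradictory? : ∀ d m p α β γ → Dec (Contradictory d m p α β γ)
contradictory? d m p α β γ = _ <? _

-- Excluding size p + 1 suffices, since the first p + 1 words of a larger family are again
-- neighborly. The three numerical conditions are verified by evaluation.
bound-suc : ∀ {d N} m p α β γ → Bound d N → {True (N + m ≟ suc p)} →
  {True (lineBelow? (suc d) α β γ)} → {True (contradictory? (suc d) m p α β γ)} → Bound (suc d) p
bound-suc {d} {N} m p α β γ bound {e} {l} {c} {n} K nb with n ≤? p
... | yes n≤p = n≤p
... | no  n≰p = contradiction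
  (λ {a} {b} a≢b → nb {inject≤ a (≰⇒> n≰p)} {inject≤ b (≰⇒> n≰p)} (a≢b ∘ inject≤-injective (≰⇒> n≰p) (≰⇒> n≰p) a b))
  (noFamily {N = N} {m} {p} {α} {β} {γ} bound (toWitness e) (toWitness l) (toWitness c) (λ a → K (inject≤ a (≰⇒> n≰p))))

-- Bounds in dimensions 0 to 10

bound-0 : Bound 0 1
bound-0 {zero}        K nb = z≤n
bound-0 {suc zero}    K nb = ≤-refl
bound-0 {suc (suc n)} K nb = contradiction (proj₁ (nb {zero} {suc zero} λ ())) λ ()

-- The line (β − γ s) / α supports the weights near the average support of the excluded family.
bound-1 : Bound 1 2
bound-1 = bound-suc 2 2 1 2 0 bound-0

bound-2 : Bound 2 4
bound-2 = bound-suc 3 4 1 3 0 bound-1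

bound-3 : Bound 3 6
bound-3 = bound-suc 3 6 3 24 4 bound-2

bound-4 : Bound 4 9
bound-4 = bound-suc 4 9 4 64 11 bound-3

bound-5 : Bound 5 14
bound-5 = bound-suc 6 14 1 26 4 bound-4

bound-6 : Bound 6 21
bound-6 = bound-suc 8 21 1 52 8 bound-5

bound-7 : Bound 7 29
bound-7 = bound-suc 9 29 1 74 10 bound-6

bound-8 : Bound 8 45
bound-8 = bound-suc 17 45 1 148 20 bound-7

-- Sharper than the value 70 asserted in the end; dimension 10 starts from 66, with m = 96 - 66 =
-- 30.
bound-9 : Bound 9 66
bound-9 = bound-suc 22 66 1 296 40 bound-8

bound-10 : Bound 10 95
bound-10 = bound-suc 30 95 1 400 48 bound-9

-- From boxes to words

agree : Letter → Letter → Bool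
agree x y = differ x y ≡ᵇ 0

agree+differ≡1 : ∀ x y → indicator (agree x y) ℕ.+ differ x y ≡ 1
agree+differ≡1 𝟎 𝟎 = refl
agree+differ≡1 𝟎 𝟏 = refl
agree+differ≡1 𝟎 ✶ = refl
agree+differ≡1 𝟏 𝟎 = refl
agree+differ≡1 𝟏 𝟏 = refl
agree+differ≡1 𝟏 ✶ = refl
agree+differ≡1 ✶ _ = refl

count-agree+dist≡d : ∀ {d} (u v : Word d) → count (λ j → agree (u j) (v j)) ℕ.+ dist u v ≡ d
count-agree+dist≡d {d} u v = begin
  count (λ j → agree (u j) (v j)) ℕ.+ dist u v
    ≡⟨ ∑-distrib-+ (λ j → indicator (agree (u j) (v j))) (λ j → differ (u j) (v j)) ⟨
  sum (λ j → indicator (agree (u j) (v j)) ℕ.+ differ (u j) (v j))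
    ≡⟨ sum-cong-≗ (λ j → agree+differ≡1 (u j) (v j)) ⟩
  sum {d} (const 1)
    ≡⟨ trans (sum-const d 1) (ℕ.*-identityʳ d) ⟩
  d ∎
  where open ≡-Reasoning

indicator≤1 : ∀ b → indicator b ℕ.≤ 1
indicator≤1 true  = ℕ.≤-refl
indicator≤1 false = z≤n

count≡d⇒true : ∀ {d} (f : Fin d → Bool) → count f ≡ d → ∀ j → f j ≡ true
count≡d⇒true {d} f count≡d j with f j in eq
... | true  = refl
... | false = contradiction
  (ℕ.<-≤-trans (sum-mono-< {f = indicator ∘ f} {const 1} (indicator≤1 ∘ f) (j , subst (λ b → indicator b ℕ.< 1) (sym eq) ℕ.≤-refl))
               (ℕ.≤-reflexive (trans (sum-const d 1) (trans (ℕ.*-identityʳ d) (sym count≡d)))))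
  (ℕ.<-irrefl refl)

module _ {m d} (K : Fin m → StandardBox d) (family : IsNeighborlyFamily 2 d K) where

  open IsNeighborlyFamily family

  -- For distinct boxes, which meet, this forces the two endpoints to coincide; for a box and itself
  -- it says that the interval is a point.
  Touch : Fin m → Fin m → Fin d → Set
  Touch a b j = upper (K a) j ≤ᴿ lower (K b) j

  -- A set that has a dimension contains a point, and a common point of the two boxes lies between
  -- these endpoints.
  lower≤upper-pair : ∀ a b j → lower (K a) j ≤ᴿ upper (K b) j
  lower≤upper-pair a b j with a ≟F b
  ... | yes refl = lower≤upper (K a) j
  ... | no  a≢b with neighborly a b a≢b
  ...   | r , dim , _ with IsMaximum.attained dim
  ...     | p , p∈ , _ = ≤ᴿ-trans {lower (K a) j} {p zero j} {upper (K b) j}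
            (proj₁ (proj₁ (p∈ zero) j)) (proj₂ (proj₂ (p∈ zero) j))

  module _ (touch? : ∀ a b j → Dec (Touch a b j)) where

    -- The dimension d of the box equals the number of its thick coordinates, so all of them are
    -- thick.
    nondegenerate : ∀ a j → ¬ Touch a a j
    nondegenerate a j touch = thick⇒¬touch (count≡d⇒true thick count≡d j) touch
      where
      thick : Fin d → Bool
      thick j = not (does (touch? a a j))
      thick⇒¬touch : ∀ {j} → thick j ≡ true → ¬ Touch a a j
      thick⇒¬touch {j} eq with touch? a a j
      ... | no ¬touch = ¬touch
      thin⇒touch : ∀ {j} → thick j ≡ false → Touch a a j
      thin⇒touch {j} eq with touch? a a j
      ... | yes touch = touch
      count≡d : count thick ≡ d
      count≡d = dimension-unique {S = region (K a)} (box-dimension (K a) thick (λ j → thick⇒¬touch) (λ j → thin⇒touch)) (fullDimensional a)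

    -- All contacts in a coordinate take place at one point: box c begins no later than b ends, and
    -- vice versa, so the end of a passes through the beginning of b and the end of c to the
    -- beginning of e.
    squeeze : ∀ {a b c e j} → Touch a b j → Touch c e j → Touch a e j
    squeeze {a} {b} {c} {e} {j} ab ce = ≤ᴿ-trans {upper (K a) j} {lower (K b) j} {lower (K e) j} ab
      (≤ᴿ-trans {lower (K b) j} {upper (K c) j} {lower (K e) j} (lower≤upper-pair b c j) ce)

    letter : Fin m → Word d
    letter a j with any? (λ b → touch? a b j) | any? (λ b → touch? b a j)
    ... | yes _ | _     = 𝟎
    ... | no  _ | yes _ = 𝟏
    ... | no  _ | no  _ = ✶

    touch⇒𝟎 : ∀ {a b j} → Touch a b j → letter a j ≡ 𝟎
    touch⇒𝟎 {a} {b} {j} ab with any? (λ b → touch? a b j)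
    ... | yes _ = refl
    ... | no ¬∃ = contradiction (b , ab) ¬∃

    -- If b also ended at the point of contact, `squeeze` would make it degenerate; hence the test
    -- for 𝟎 fails.
    touch⇒𝟏 : ∀ {a b j} → Touch a b j → letter b j ≡ 𝟏
    touch⇒𝟏 {a} {b} {j} ab with any? (λ c → touch? b c j) | any? (λ c → touch? c b j)
    ... | yes (c , bc) | _     = contradiction (squeeze {b} {c} {a} {b} bc ab) (nondegenerate b j)
    ... | no _         | yes _ = refl
    ... | no _         | no ¬∃ = contradiction (a , ab) ¬∃

    𝟎⇒touch : ∀ {a j} → letter a j ≡ 𝟎 → ∃ λ b → Touch a b j
    𝟎⇒touch {a} {j} eq with any? (λ b → touch? a b j) | any? (λ b → touch? b a j)
    𝟎⇒touch eq | yes touch | _     = touch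
    𝟎⇒touch () | no _      | yes _
    𝟎⇒touch () | no _      | no  _

    𝟏⇒touch : ∀ {b j} → letter b j ≡ 𝟏 → ∃ λ a → Touch a b j
    𝟏⇒touch {b} {j} eq with any? (λ c → touch? b c j) | any? (λ c → touch? c b j)
    𝟏⇒touch () | yes _ | _
    𝟏⇒touch eq | no _  | yes touch = touch
    𝟏⇒touch () | no _  | no _

    -- The letters only say that each box touches some box; `squeeze` shows that the two then touch
    -- each other.
    disagree⇒touch : ∀ a b j → agree (letter a j) (letter b j) ≡ false → Touch a b j ⊎ Touch b a j
    disagree⇒touch a b j eq with letter a j in la | letter b j in lb
    disagree⇒touch a b j eq | 𝟎 | 𝟏 with 𝟎⇒touch {a} la | 𝟏⇒touch {b} lb
    ... | c , ac | e , eb = inj₁ (squeeze {a} {c} {e} {b} ac eb)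
    disagree⇒touch a b j eq | 𝟏 | 𝟎 with 𝟏⇒touch {a} la | 𝟎⇒touch {b} lb
    ... | e , ea | c , bc = inj₂ (squeeze {b} {c} {e} {a} bc ea)
    disagree⇒touch a b j () | 𝟎 | 𝟎
    disagree⇒touch a b j () | 𝟎 | ✶
    disagree⇒touch a b j () | 𝟏 | 𝟏
    disagree⇒touch a b j () | 𝟏 | ✶
    disagree⇒touch a b j () | ✶ | _

    agree⇒¬touch : ∀ a b j → agree (letter a j) (letter b j) ≡ true → ¬ Touch a b j
    agree⇒¬touch a b j eq ab rewrite touch⇒𝟎 {a} {b} ab | touch⇒𝟏 {a} {b} ab = contradiction eq λ ()

    agree-sym : ∀ a b j → agree (letter a j) (letter b j) ≡ true → agree (letter b j) (letter a j) ≡ true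
    agree-sym a b j eq rewrite differ-sym (letter b j) (letter a j) = eq

    module _ (lower-total : ∀ a b j → lower (K a) j ≤ᴿ lower (K b) j ⊎ lower (K b) j ≤ᴿ lower (K a) j)
             (upper-total : ∀ a b j → upper (K a) j ≤ᴿ upper (K b) j ⊎ upper (K b) j ≤ᴿ upper (K a) j) where

      -- The dimension of the intersection is the number of agreeing positions. As dimensions are
      -- unique, that number is the given r, and the distance of the words is d - r.
      letter-neighborly : Neighborly letter
      letter-neighborly {a} {b} a≢b with neighborly a b a≢b
      ... | r , dim , d∸2≤r , r<d = positive-distance , distance≤2
        where
        e : ℕ
        e = count (λ j → agree (letter a j) (letter b j))
        e≡r : e ≡ r
        e≡r = dimension-unique {S = region (K a) ∩ region (K b)}
          (intersection-dimension (K a) (K b) (λ j → agree (letter a j) (letter b j))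
            (lower-total a b) (upper-total a b) (nondegenerate a) (nondegenerate b)
            (lower≤upper-pair a b) (lower≤upper-pair b a)
            (λ j eq → agree⇒¬touch a b j eq , agree⇒¬touch b a j (agree-sym a b j eq))
            (disagree⇒touch a b))
          dim
        r+dist≡d : r ℕ.+ dist (letter a) (letter b) ≡ d
        r+dist≡d = trans (cong (ℕ._+ dist (letter a) (letter b)) (sym e≡r)) (count-agree+dist≡d (letter a) (letter b))
        positive-distance : 1 ℕ.≤ dist (letter a) (letter b)
        positive-distance = ℕ.+-cancelˡ-≤ r 1 _
          (ℕ.≤-trans (ℕ.≤-reflexive (ℕ.+-comm r 1)) (ℕ.≤-trans r<d (ℕ.≤-reflexive (sym r+dist≡d))))
        distance≤2 : dist (letter a) (letter b) ℕ.≤ 2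
        -- With truncated subtraction, d ≤ 2 + (d ∸ 2) holds for d < 2 as well.
        distance≤2 = ℕ.+-cancelˡ-≤ r _ 2 (ℕ.≤-trans (ℕ.≤-reflexive r+dist≡d)
          (ℕ.≤-trans (ℕ.m≤n+m∸n d 2) (ℕ.≤-trans (ℕ.+-monoʳ-≤ 2 d∸2≤r) (ℕ.≤-reflexive (ℕ.+-comm 2 r)))))

-- Discharging the comparisons of endpoints under double negation

¬¬-∀ : ∀ {n} {P : Fin n → Set} → (∀ i → ¬ ¬ P i) → ¬ ¬ (∀ i → P i)
¬¬-∀ = sequence (RawMonad.rawApplicative ¬¬-Monad)

¬¬-total : ∀ x y → ¬ ¬ (x ≤ᴿ y ⊎ y ≤ᴿ x)
¬¬-total x y k = k (inj₂ (≰ᴿ⇒≥ᴿ {x} {y} (k ∘ inj₁)))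

-- Only finitely many comparisons of endpoints are needed, and finitely many double negations
-- combine into one.
¬¬-words : ∀ {m d} (K : Fin m → StandardBox d) → IsNeighborlyFamily 2 d K →
  ¬ ¬ (∃ λ (W : Fin m → Word d) → Neighborly W)
¬¬-words K family ret =
  ¬¬-∀ (λ a → ¬¬-∀ λ b → ¬¬-∀ λ j → ¬¬-excluded-middle) λ touch? →
  ¬¬-∀ (λ a → ¬¬-∀ λ b → ¬¬-∀ λ j → ¬¬-total (lower (K a) j) (lower (K b) j)) λ lower-total →
  ¬¬-∀ (λ a → ¬¬-∀ λ b → ¬¬-∀ λ j → ¬¬-total (upper (K a) j) (upper (K b) j)) λ upper-total →
  ret (letter K family touch? , letter-neighborly K family touch? lower-total upper-total)

bound⇒n≤ : ∀ {d N} → Bound d N → n⟨ 2 , d ⟩≤ N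
bound⇒n≤ {N = N} bound m (K , family) = decidable-stable (m ℕ.≤? N) λ m≰N →
  ¬¬-words K family λ (W , nb) → m≰N (bound W nb)

-- Nine boxes in dimension four

-- The letters 𝟎, 𝟏, ✶ become the intervals [0,1], [1,2], [0,2], all of which contain 1.
lowerEnd upperEnd : Letter → ℚ
lowerEnd 𝟎 = 0ℚ
lowerEnd 𝟏 = 1ℚ
lowerEnd ✶ = 0ℚ
upperEnd 𝟎 = 1ℚ
upperEnd 𝟏 = 1ℚ ℚ.+ 1ℚ
upperEnd ✶ = 1ℚ ℚ.+ 1ℚ

lowerEnd≤1 : ∀ x → lowerEnd x ℚ.≤ 1ℚ
lowerEnd≤1 𝟎 = from-yes (0ℚ ℚ.≤? 1ℚ)
lowerEnd≤1 𝟏 = ℚ.≤-refl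
lowerEnd≤1 ✶ = from-yes (0ℚ ℚ.≤? 1ℚ)

1≤upperEnd : ∀ x → 1ℚ ℚ.≤ upperEnd x
1≤upperEnd 𝟎 = ℚ.≤-refl
1≤upperEnd 𝟏 = from-yes (1ℚ ℚ.≤? 1ℚ ℚ.+ 1ℚ)
1≤upperEnd ✶ = from-yes (1ℚ ℚ.≤? 1ℚ ℚ.+ 1ℚ)

agree⇒lowerEnd<upperEnd : ∀ x y → agree x y ≡ true → lowerEnd y ℚ.< upperEnd x
agree⇒lowerEnd<upperEnd 𝟎 𝟎 _ = from-yes (0ℚ ℚ.<? 1ℚ)
agree⇒lowerEnd<upperEnd 𝟎 ✶ _ = from-yes (0ℚ ℚ.<? 1ℚ)
agree⇒lowerEnd<upperEnd 𝟏 𝟏 _ = from-yes (1ℚ ℚ.<? 1ℚ ℚ.+ 1ℚ)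
agree⇒lowerEnd<upperEnd 𝟏 ✶ _ = from-yes (0ℚ ℚ.<? 1ℚ ℚ.+ 1ℚ)
agree⇒lowerEnd<upperEnd ✶ 𝟎 _ = from-yes (0ℚ ℚ.<? 1ℚ ℚ.+ 1ℚ)
agree⇒lowerEnd<upperEnd ✶ 𝟏 _ = from-yes (1ℚ ℚ.<? 1ℚ ℚ.+ 1ℚ)
agree⇒lowerEnd<upperEnd ✶ ✶ _ = from-yes (0ℚ ℚ.<? 1ℚ ℚ.+ 1ℚ)
agree⇒lowerEnd<upperEnd 𝟎 𝟏 ()
agree⇒lowerEnd<upperEnd 𝟏 𝟎 ()

disagree⇒upperEnd≤lowerEnd : ∀ x y → agree x y ≡ false →
  upperEnd x ℚ.≤ lowerEnd y ⊎ upperEnd y ℚ.≤ lowerEnd x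
disagree⇒upperEnd≤lowerEnd 𝟎 𝟏 _ = inj₁ ℚ.≤-refl
disagree⇒upperEnd≤lowerEnd 𝟏 𝟎 _ = inj₂ ℚ.≤-refl
disagree⇒upperEnd≤lowerEnd 𝟎 𝟎 ()
disagree⇒upperEnd≤lowerEnd 𝟎 ✶ ()
disagree⇒upperEnd≤lowerEnd 𝟏 𝟏 ()
disagree⇒upperEnd≤lowerEnd 𝟏 ✶ ()
disagree⇒upperEnd≤lowerEnd ✶ _ ()

agree-refl : ∀ x → agree x x ≡ true
agree-refl 𝟎 = refl
agree-refl 𝟏 = refl
agree-refl ✶ = refl

fromℚ-total : ∀ p q → fromℚ p ≤ᴿ fromℚ q ⊎ fromℚ q ≤ᴿ fromℚ p
fromℚ-total p q = [ inj₁ ∘ fromℚ-mono-≤ , inj₂ ∘ fromℚ-mono-≤ ]′ (ℚ.≤-total p q)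

fromℚ-< : ∀ {p q} → p ℚ.< q → ¬ fromℚ q ≤ᴿ fromℚ p
fromℚ-< p<q q≤p = <⇒≱ℚ p<q (fromℚ-cancel-≤ q≤p)

box : ∀ {d} → Word d → StandardBox d
box u = record
  { lower = fromℚ ∘ lowerEnd ∘ u
  ; upper = fromℚ ∘ upperEnd ∘ u
  ; lower≤upper = λ j → fromℚ-mono-≤ (ℚ.≤-trans (lowerEnd≤1 (u j)) (1≤upperEnd (u j)))
  }

box-nondegenerate : ∀ {d} (u : Word d) j → ¬ upper (box u) j ≤ᴿ lower (box u) j
box-nondegenerate u j = fromℚ-< (agree⇒lowerEnd<upperEnd (u j) (u j) (agree-refl (u j)))

-- The intervals of 𝟎 and 𝟏 meet only in the point 1, those of any other two letters in positive
-- length. Hence the codimension of an intersection is the distance of the words.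
neighborly⇒family : ∀ {n d} (W : Fin n → Word d) → Neighborly W → IsNeighborlyFamily 2 d (box ∘ W)
neighborly⇒family {d = d} W nb = record
  { fullDimensional = λ a → subst (HasDimension (region (box (W a)))) (trans (sum-const d 1) (ℕ.*-identityʳ d))
      (box-dimension (box (W a)) (const true) (λ j _ → box-nondegenerate (W a) j) (λ j ()))
  ; neighborly = λ a b a≢b → count (λ j → agree (W a j) (W b j))
      , intersection-dimension (box (W a)) (box (W b)) (λ j → agree (W a j) (W b j))
          (λ j → fromℚ-total _ _) (λ j → fromℚ-total _ _)
          (box-nondegenerate (W a)) (box-nondegenerate (W b))
          (λ j → fromℚ-mono-≤ (ℚ.≤-trans (lowerEnd≤1 (W a j)) (1≤upperEnd (W b j))))
          (λ j → fromℚ-mono-≤ (ℚ.≤-trans (lowerEnd≤1 (W b j)) (1≤upperEnd (W a j))))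
          (λ j eq → fromℚ-< (agree⇒lowerEnd<upperEnd (W a j) (W b j) eq)
                  , fromℚ-< (agree⇒lowerEnd<upperEnd (W b j) (W a j)
                      (trans (cong (_≡ᵇ 0) (differ-sym (W b j) (W a j))) eq)))
          (λ j eq → [ inj₁ ∘ fromℚ-mono-≤ , inj₂ ∘ fromℚ-mono-≤ ]′ (disagree⇒upperEnd≤lowerEnd (W a j) (W b j) eq))
      , intersection-size (W a) (W b) (nb a≢b)
  }
  where
  intersection-size : ∀ {d} (u v : Word d) → 1 ℕ.≤ dist u v × dist u v ℕ.≤ 2 →
    d ℕ.∸ 2 ℕ.≤ count (λ j → agree (u j) (v j)) × count (λ j → agree (u j) (v j)) ℕ.< d
  intersection-size {d} u v (1≤ , ≤2) =
    ℕ.m≤n+o⇒m∸n≤o d 2 (ℕ.≤-trans (ℕ.≤-reflexive (sym (count-agree+dist≡d u v)))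
      (ℕ.≤-trans (ℕ.+-monoʳ-≤ _ ≤2) (ℕ.≤-reflexive (ℕ.+-comm _ 2)))) ,
    ℕ.≤-trans (ℕ.≤-trans (ℕ.≤-reflexive (ℕ.+-comm 1 _)) (ℕ.+-monoʳ-≤ _ 1≤)) (ℕ.≤-reflexive (count-agree+dist≡d u v))

-- 0✶, 10, 11 are pairwise at distance 1, so pairs of them are at distance 1 or 2.
stairs : Fin 3 → Word 2
stairs zero             = 𝟎 ∷ ✶ ∷ []
stairs (suc zero)       = 𝟏 ∷ 𝟎 ∷ []
stairs (suc (suc zero)) = 𝟏 ∷ 𝟏 ∷ []

nineWords : Fin 9 → Word 4
nineWords a = stairs (quotient {3} 3 a) ++ stairs (remainder {3} 3 a)

nineWords-neighborly : Neighborly nineWords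
nineWords-neighborly {a} {b} a≢b = from-yes
  (all? λ a → all? λ b → ¬? (a ≟F b) →-dec ((1 ℕ.≤? dist (nineWords a) (nineWords b)) ×-dec (dist (nineWords a) (nineWords b) ℕ.≤? 2))) a b a≢b

corollary1p6 : (n⟨ 2 , 4 ⟩≡ 9) × (n⟨ 2 , 5 ⟩≤ 14) × (n⟨ 2 , 6 ⟩≤ 21) × (n⟨ 2 , 7 ⟩≤ 29) ×
    (n⟨ 2 , 8 ⟩≤ 45) × (n⟨ 2 , 9 ⟩≤ 70) × (n⟨ 2 , 10 ⟩≤ 95)
corollary1p6 =
  record { attained = box ∘ nineWords , neighborly⇒family nineWords nineWords-neighborly
         ; upperBound = bound⇒n≤ bound-4 } ,
  bound⇒n≤ bound-5 , bound⇒n≤ bound-6 , bound⇒n≤ bound-7 , bound⇒n≤ bound-8 ,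
  bound⇒n≤ (λ K nb → ℕ.≤-trans (bound-9 K nb) (ℕ.m≤m+n 66 4)) , bound⇒n≤ bound-10
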